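{- Let $s,l\in\mathbb{N}$, $k_1,\dots,k_l,t_1,\dots,t_l\in\mathbb{N}'$ and $m_1,\dots,m_l\in\mathbb{Z}$, let $(G_n)$ be a bivariate Gibonacci polynomial sequence, and put $K=t_1k_1+\cdots+t_lk_l$. Then for all $n\in\mathbb{N}'$, $$G_{st_1n+m_1}^{k_1}\cdots G_{st_ln+m_l}^{k_l}=(-1)^{s+1}\sum_{i=0}^{K}\sum_{j=0}^{i}(-1)^{\frac{(sj+2(s+1))(j+1)}{2}}\binom{K+1}{j}_{F_s}G_{m_1+st_1(i-j)}^{k_1}\cdots G_{m_l+st_l(i-j)}^{k_l}\,y^{\frac{sj(j-1)}{2}}\binom{n+K-i}{K}_{F_s}.$$
   Context: $\mathbb{N}=\{1,2,\dots\}$, $\mathbb{N}'=\mathbb{N}\cup\{0\}$. $x,y$ are indeterminates and we abbreviate $F_n=F_n(x,y)$, $G_n=G_n(x,y)$. The bivariate Fibonacci polynomials are $F_0=0$, $F_1=1$, $F_{n+2}=xF_{n+1}+yF_n$, extended to negative indices by $F_{ -n}=-(-y)^{ -n}F_n$ ($n\in\mathbb{N}$). A bivariate Gibonacci polynomial sequence $(G_n)$ is given by $G_n=xG_{n-1}+yG_{n-2}$ with arbitrary initial conditions $G_0,G_1$ (elements of $\mathbb{C}(x,y)$, e.g. polynomials), extended to all integer indices by the same recurrence, equivalently $G_n=yG_0F_{n-1}+G_1F_n$ for all $n\in\mathbb{Z}$. For $n,k\in\mathbb{N}'$ the bivariate $s$-Fibopolynomial is $\binom{n}{k}_{F_s}=\frac{F_{sn}F_{s(n-1)}\cdots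 F_{s(n-k+1)}}{F_sF_{2s}\cdots F_{ks}}$ (equal to $1$ for $k=0$ and $k=n$, and to $0$ if $k>n$). Zeroth powers equal $1$. -}

module Defs where

open import Algebra.Bundles using (CommutativeRing; Semiring)
import Algebra.Definitions.RawSemiring as RawSemiringDefs
import Algebra.Properties.Ring as RingProperties
import Algebra.Solver.Ring.NaturalCoefficients.Default as SemiringSolver
open import Data.Empty using (⊥-elim)
open import Data.Fin.Base as Fin using (toℕ)
open import Data.Integer.Base as ℤ using (ℤ)
open import Data.List.Base using (List; []; _∷_; map)
open import Data.Nat.Base as ℕ using (ℕ; zero; suc; _⊔_)
import Data.Nat.Properties as ℕₚ
open import Data.Product.Base using (_×_; _,_; ∃-syntax)
open import Data.Rational.Base as Rat using (ℚ; 0ℚ; 1ℚ; ½; ∣_∣)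
import Data.Rational.Properties as ℚₚ
import Data.Rational.Solver as ℚ-Solver
open import Data.Sum.Base using (_⊎_; inj₁; inj₂)
open import Data.Vec.Functional using (Vector; foldr)
open import Function.Base using (_∘_)
open import Level using (0ℓ)
open import Relation.Binary.Bundles using (Setoid)
open import Relation.Binary.Core using (Rel)
import Relation.Binary.Reasoning.Setoid as SetoidReasoning
open import Relation.Binary.Structures using (IsEquivalence)
open import Relation.Binary.PropositionalEquality.Core
  using (_≡_; cong; cong₂; subst; subst₂)
  renaming (refl to ≡-refl; sym to ≡-sym; trans to ≡-trans)
open import Relation.Nullary using (¬_; yes; no)

Ring : Set₁
Ring = CommutativeRing 0ℓ 0ℓ

-- A list of laws without the redundancies of IsCommutativeRing.
record RingLaws {A : Set} (_≈_ : Rel A 0ℓ) (_+_ _*_ : A → A → A)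
                (-_ : A → A) (0# 1# : A) : Set where
  field
    isEquivalence : IsEquivalence _≈_
    +-cong      : ∀ {x x′ y y′} → x ≈ x′ → y ≈ y′ → (x + y) ≈ (x′ + y′)
    *-cong      : ∀ {x x′ y y′} → x ≈ x′ → y ≈ y′ → (x * y) ≈ (x′ * y′)
    -‿cong      : ∀ {x x′} → x ≈ x′ → (- x) ≈ (- x′)
    +-assoc     : ∀ x y z → ((x + y) + z) ≈ (x + (y + z))
    +-comm      : ∀ x y → (x + y) ≈ (y + x)
    +-identityˡ : ∀ x → (0# + x) ≈ x
    -‿inverseˡ  : ∀ x → ((- x) + x) ≈ 0#
    *-assoc     : ∀ x y z → ((x * y) * z) ≈ (x * (y * z))
    *-comm      : ∀ x y → (x * y) ≈ (y * x)
    *-identityˡ : ∀ x → (1# * x) ≈ x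
    distribˡ    : ∀ x y z → (x * (y + z)) ≈ ((x * y) + (x * z))

  open IsEquivalence isEquivalence public
    renaming (refl to ≈-refl; sym to ≈-sym; trans to ≈-trans)

  commutativeRing : Ring
  commutativeRing = record
    { Carrier = A ; _≈_ = _≈_ ; _+_ = _+_ ; _*_ = _*_ ; -_ = -_
    ; 0# = 0# ; 1# = 1#
    ; isCommutativeRing = record
      { isRing = record
        { +-isAbelianGroup = record
          { isGroup = record
            { isMonoid = record
              { isSemigroup = record
                { isMagma = record
                  { isEquivalence = isEquivalence ; ∙-cong = +-cong }
                ; assoc = +-assoc
                }
              ; identity = +-identityˡ
                         , λ x → ≈-trans (+-comm x 0#) (+-identityˡ x)
              }
            ; inverse = -‿inverseˡ
                      , λ x → ≈-trans (+-comm x (- x)) (-‿inverseˡ x)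
            ; ⁻¹-cong = -‿cong
            }
          ; comm = +-comm
          }
        ; *-cong = *-cong
        ; *-assoc = *-assoc
        ; *-identity = *-identityˡ
                     , λ x → ≈-trans (*-comm x 1#) (*-identityˡ x)
        ; distrib = distribˡ
                  , λ x y z → ≈-trans (*-comm (y + z) x)
                      (≈-trans (distribˡ x y z)
                        (+-cong (*-comm x y) (*-comm x z)))
        }
      ; *-comm = *-comm
      }
    }

-- Integral domains, constructively: `stable` holds classically for every
-- ring, and is what allows `integral` to be inherited by polynomial rings
-- when equality is undecidable, as it is over ℝ and ℂ.
record IsDomain (R : Ring) : Set where
  open CommutativeRing R
  field
    1≉0      : ¬ 1# ≈ 0#
    integral : ∀ x y → ¬ x ≈ 0# → x * y ≈ 0# → y ≈ 0#
    stable   : ∀ x → ¬ ¬ x ≈ 0# → x ≈ 0#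

  *-≉0 : ∀ {x y} → ¬ x ≈ 0# → ¬ y ≈ 0# → ¬ x * y ≈ 0#
  *-≉0 x≉0 y≉0 xy≈0 = y≉0 (integral _ _ x≉0 xy≈0)

------------------------------------------------------------------------
-- ℝ: Cauchy sequences of rationals modulo null sequences

module _ where
  open Rat using (_<_; _-_; _+_)

  record ℝ : Set where
    no-eta-equality
    field
      seq    : ℕ → ℚ
      cauchy : ∀ ε → 0ℚ < ε → ∃[ N ]
               (∀ m n → N ℕ.≤ m → N ℕ.≤ n → ∣ seq m - seq n ∣ < ε)

  open ℝ public

  infix 4 _≈ʳ_
  record _≈ʳ_ (x y : ℝ) : Set where
    constructor mk≈
    field
      close : ∀ ε → 0ℚ < ε → ∃[ N ]
              (∀ n → N ℕ.≤ n → ∣ seq x n - seq y n ∣ < ε)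

  open _≈ʳ_ public

module ℚ-lemmas where
  open Rat using (_<_; _≤_; _-_; _+_; _*_; -_; 1/_; Positive; NonNegative)
  open ℚ-Solver.+-*-Solver using (solve; _:=_; _:+_; _:*_; :-_; _:-_; con)

  <⇒≱ : ∀ {p q} → p < q → ¬ q ≤ p
  <⇒≱ p<q q≤p = ℚₚ.<-irrefl ≡-refl (ℚₚ.<-≤-trans p<q q≤p)

  halve : ∀ ε → 0ℚ < ε → ∃[ δ ] 0ℚ < δ × δ + δ ≡ ε
  halve ε ε>0 = ½ * ε
    , subst (_< ½ * ε) (ℚₚ.*-zeroʳ ½) (ℚₚ.*-monoʳ-<-pos ½ ε>0)
    , ≡-trans (≡-sym (ℚₚ.*-distribʳ-+ ε ½ ½)) (ℚₚ.*-identityˡ ε)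

  *-pos : ∀ {p q} → 0ℚ < p → 0ℚ < q → 0ℚ < p * q
  *-pos {p} {q} p>0 q>0 =
    ℚₚ.positive⁻¹ (p * q) {{ℚₚ.pos*pos⇒pos p {{Rat.positive p>0}} q {{Rat.positive q>0}}}}

  quotient : ∀ B ε → 0ℚ < B → 0ℚ < ε → ∃[ δ ] 0ℚ < δ × B * δ ≡ ε
  quotient B ε B>0 ε>0 = (1/ B) * ε
    , *-pos (ℚₚ.positive⁻¹ (1/ B) {{ℚₚ.1/pos⇒pos B}}) ε>0
    , ≡-trans (≡-sym (ℚₚ.*-assoc B (1/ B) ε))
        (≡-trans (cong (_* ε) (ℚₚ.*-inverseʳ B)) (ℚₚ.*-identityˡ ε))
    where instance
      posB : Positive B
      posB = Rat.positive B>0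
      nzB : Rat.NonZero B
      nzB = ℚₚ.pos⇒nonZero B

  *-<-* : ∀ {a b B δ} → 0ℚ ≤ a → a < B → 0ℚ ≤ b → b < δ → a * b < B * δ
  *-<-* {a} {b} {B} {δ} 0≤a a<B 0≤b b<δ = ℚₚ.≤-<-trans
    (ℚₚ.*-monoˡ-≤-nonNeg a {{Rat.nonNegative 0≤a}} (ℚₚ.<⇒≤ b<δ))
    (ℚₚ.*-monoˡ-<-pos δ {{Rat.positive (ℚₚ.≤-<-trans 0≤b b<δ)}} a<B)

  dist-self : ∀ p {ε} → 0ℚ < ε → ∣ p - p ∣ < ε
  dist-self p {ε} = subst (_< ε) (≡-sym (cong ∣_∣ (ℚₚ.+-inverseʳ p)))

  dist-≡ : ∀ {p q ε} → p ≡ q → 0ℚ < ε → ∣ p - q ∣ < ε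
  dist-≡ {p} ≡-refl = dist-self p

  dist-sym : ∀ p q → ∣ p - q ∣ ≡ ∣ q - p ∣
  dist-sym p q = ≡-trans (≡-sym (ℚₚ.∣-p∣≡∣p∣ (p - q)))
    (cong ∣_∣ (solve 2 (λ p q → :- (p :- q) := q :- p) ≡-refl p q))

  ∣+∣-< : ∀ {p q ε δ} → ∣ p ∣ < ε → ∣ q ∣ < δ → ∣ p + q ∣ < ε + δ
  ∣+∣-< {p} {q} p< q< = ℚₚ.≤-<-trans (ℚₚ.∣p+q∣≤∣p∣+∣q∣ p q) (ℚₚ.+-mono-< p< q<)

  ∣*∣-< : ∀ {p q ε δ} → ∣ p ∣ < ε → ∣ q ∣ < δ → ∣ p * q ∣ < ε * δ
  ∣*∣-< {p} {q} {ε} {δ} p< q< =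
    subst (_< ε * δ) (≡-sym (ℚₚ.∣p*q∣≡∣p∣*∣q∣ p q))
      (*-<-* (ℚₚ.0≤∣p∣ p) p< (ℚₚ.0≤∣p∣ q) q<)

  dist-trans : ∀ p q r {ε δ} → ∣ p - q ∣ < ε → ∣ q - r ∣ < δ → ∣ p - r ∣ < ε + δ
  dist-trans p q r pq qr = subst (λ d → ∣ d ∣ < _)
    (solve 3 (λ p q r → (p :- q) :+ (q :- r) := p :- r) ≡-refl p q r)
    (∣+∣-< pq qr)

  dist-+ : ∀ p p′ q q′ {ε δ} → ∣ p - p′ ∣ < ε → ∣ q - q′ ∣ < δ →
           ∣ (p + q) - (p′ + q′) ∣ < ε + δ
  dist-+ p p′ q q′ pp qq = subst (λ d → ∣ d ∣ < _)
    (solve 4 (λ p p′ q q′ → (p :- p′) :+ (q :- q′) := (p :+ q) :- (p′ :+ q′))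
       ≡-refl p p′ q q′)
    (∣+∣-< pp qq)

  dist-neg : ∀ p q {ε} → ∣ p - q ∣ < ε → ∣ (- p) - (- q) ∣ < ε
  dist-neg p q {ε} = subst (_< ε)
    (≡-trans (≡-sym (ℚₚ.∣-p∣≡∣p∣ (p - q)))
      (cong ∣_∣ (solve 2 (λ p q → :- (p :- q) := (:- p) :- (:- q)) ≡-refl p q)))

  dist-* : ∀ p p′ q q′ {A B ε δ} → ∣ p ∣ < A → ∣ q′ ∣ < B →
           ∣ p - p′ ∣ < ε → ∣ q - q′ ∣ < δ →
           ∣ (p * q) - (p′ * q′) ∣ < A * δ + B * ε
  dist-* p p′ q q′ {A} {B} {ε} {δ} p< q′< pp qq = subst (λ d → ∣ d ∣ < _)
    (solve 4 (λ p p′ q q′ → p :* (q :- q′) :+ q′ :* (p :- p′)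
                         := (p :* q) :- (p′ :* q′)) ≡-refl p p′ q q′)
    (∣+∣-< {p * (q - q′)} {q′ * (p - p′)} (∣*∣-< {p} p< qq) (∣*∣-< {q′} q′< pp))

  square-± : ∀ p a → a ≡ p ⊎ a ≡ - p → a * a ≡ p * p
  square-± p a (inj₁ ≡-refl) = ≡-refl
  square-± p a (inj₂ ≡-refl) = ≡-trans (≡-sym (ℚₚ.neg-distribˡ-* p (- p)))
    (≡-trans (cong (-_) (≡-sym (ℚₚ.neg-distribʳ-* p p))) (neg-neg (p * p)))
    where
    neg-neg : ∀ q → - (- q) ≡ q
    neg-neg = solve 1 (λ q → :- (:- q) := q) ≡-refl

  ∣p∣²≡p² : ∀ p → ∣ p ∣ * ∣ p ∣ ≡ p * p
  ∣p∣²≡p² p = square-± p ∣ p ∣ (ℚₚ.∣p∣≡p∨∣p∣≡-p p)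

  shift : ∀ p q → (p - q) + q ≡ p
  shift = solve 2 (λ p q → (p :- q) :+ q := p) ≡-refl

  p-0≡p : ∀ p → p - 0ℚ ≡ p
  p-0≡p p = ℚₚ.+-identityʳ p

open ℚ-lemmas

module _ where
  open Rat using (_<_; _≤_; _-_; _+_; _*_; -_)

  bounded : ∀ x → ∃[ B ] 0ℚ < B × ∃[ N ] (∀ n → N ℕ.≤ n → ∣ seq x n ∣ < B)
  bounded x with cauchy x 1ℚ (ℚₚ.positive⁻¹ 1ℚ)
  ... | N , cau = 1ℚ + ∣ seq x N ∣
                , ℚₚ.+-mono-<-≤ (ℚₚ.positive⁻¹ 1ℚ) (ℚₚ.0≤∣p∣ (seq x N))
                , N , λ n N≤n → subst (_< 1ℚ + ∣ seq x N ∣) (cong ∣_∣ (shift (seq x n) (seq x N)))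
                    (ℚₚ.≤-<-trans (ℚₚ.∣p+q∣≤∣p∣+∣q∣ (seq x n - seq x N) (seq x N))
                      (ℚₚ.+-mono-<-≤ (cau n N N≤n ℕₚ.≤-refl) (ℚₚ.≤-refl {∣ seq x N ∣})))

  infixl 6 _+ʳ_
  infixl 7 _*ʳ_

  _+ʳ_ : ℝ → ℝ → ℝ
  (x +ʳ y) .seq n = seq x n + seq y n
  (x +ʳ y) .cauchy ε ε>0 =
    let δ , δ>0 , δ+δ≡ε = halve ε ε>0
        M , cx = cauchy x δ δ>0
        N , cy = cauchy y δ δ>0
    in M ⊔ N , λ m n ≤m ≤n → subst (_ <_) δ+δ≡ε
         (dist-+ (seq x m) (seq x n) (seq y m) (seq y n)
           (cx m n (ℕₚ.m⊔n≤o⇒m≤o M N ≤m) (ℕₚ.m⊔n≤o⇒m≤o M N ≤n))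
           (cy m n (ℕₚ.m⊔n≤o⇒n≤o M N ≤m) (ℕₚ.m⊔n≤o⇒n≤o M N ≤n)))

  -ʳ_ : ℝ → ℝ
  (-ʳ x) .seq n = - seq x n
  (-ʳ x) .cauchy ε ε>0 =
    let N , cx = cauchy x ε ε>0
    in N , λ m n ≤m ≤n → dist-neg (seq x m) (seq x n) (cx m n ≤m ≤n)

  const : ℚ → ℝ
  const q .seq _ = q
  const q .cauchy ε ε>0 = 0 , λ _ _ _ _ → dist-self q ε>0

  *-modulus : ∀ A B ε → 0ℚ < A → 0ℚ < B → 0ℚ < ε →
              ∃[ δ ] ∃[ η ] 0ℚ < δ × 0ℚ < η × A * δ + B * η ≡ ε
  *-modulus A B ε A>0 B>0 ε>0 =
    let ε/2 , ε/2>0 , eq = halve ε ε>0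
        δ , δ>0 , Aδ≡ = quotient A ε/2 A>0 ε/2>0
        η , η>0 , Bη≡ = quotient B ε/2 B>0 ε/2>0
    in δ , η , δ>0 , η>0 , ≡-trans (cong₂ _+_ Aδ≡ Bη≡) eq

  _*ʳ_ : ℝ → ℝ → ℝ
  (x *ʳ y) .seq n = seq x n * seq y n
  (x *ʳ y) .cauchy ε ε>0 =
    let A , A>0 , K , bx = bounded x
        B , B>0 , L , by = bounded y
        δ , η , δ>0 , η>0 , eq = *-modulus A B ε A>0 B>0 ε>0
        M , cx = cauchy x η η>0
        N , cy = cauchy y δ δ>0
    in (K ⊔ L) ⊔ (M ⊔ N) , λ m n ≤m ≤n →
       let m-KL = ℕₚ.m⊔n≤o⇒m≤o (K ⊔ L) (M ⊔ N) ≤m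
           n-KL = ℕₚ.m⊔n≤o⇒m≤o (K ⊔ L) (M ⊔ N) ≤n
           m-MN = ℕₚ.m⊔n≤o⇒n≤o (K ⊔ L) (M ⊔ N) ≤m
           n-MN = ℕₚ.m⊔n≤o⇒n≤o (K ⊔ L) (M ⊔ N) ≤n
       in subst (_ <_) eq
         (dist-* (seq x m) (seq x n) (seq y m) (seq y n)
           (bx m (ℕₚ.m⊔n≤o⇒m≤o K L m-KL)) (by n (ℕₚ.m⊔n≤o⇒n≤o K L n-KL))
           (cx m n (ℕₚ.m⊔n≤o⇒m≤o M N m-MN) (ℕₚ.m⊔n≤o⇒m≤o M N n-MN))
           (cy m n (ℕₚ.m⊔n≤o⇒n≤o M N m-MN) (ℕₚ.m⊔n≤o⇒n≤o M N n-MN)))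

  pointwise : ∀ {x y} → (∀ n → seq x n ≡ seq y n) → x ≈ʳ y
  pointwise eq = mk≈ λ ε ε>0 → 0 , λ n _ → dist-≡ (eq n) ε>0

  ≈ʳ-isEquivalence : IsEquivalence _≈ʳ_
  ≈ʳ-isEquivalence = record
    { refl  = pointwise λ _ → ≡-refl
    ; sym   = λ {x} {y} x≈y → mk≈ λ ε ε>0 →
        let N , c = close x≈y ε ε>0
        in N , λ n N≤n → subst (_< ε) (dist-sym (seq x n) (seq y n)) (c n N≤n)
    ; trans = λ {x} {y} {z} x≈y y≈z → mk≈ λ ε ε>0 →
        let δ , δ>0 , eq = halve ε ε>0
            M , c = close x≈y δ δ>0
            N , d = close y≈z δ δ>0
        in M ⊔ N , λ n ≤n → subst (_ <_) eq
             (dist-trans (seq x n) (seq y n) (seq z n)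
               (c n (ℕₚ.m⊔n≤o⇒m≤o M N ≤n)) (d n (ℕₚ.m⊔n≤o⇒n≤o M N ≤n)))
    }

  ℝ-laws : RingLaws _≈ʳ_ _+ʳ_ _*ʳ_ -ʳ_ (const 0ℚ) (const 1ℚ)
  ℝ-laws = record
    { isEquivalence = ≈ʳ-isEquivalence
    ; +-cong = λ {x} {x′} {y} {y′} x≈ y≈ → mk≈ λ ε ε>0 →
        let δ , δ>0 , eq = halve ε ε>0
            M , c = close x≈ δ δ>0
            N , d = close y≈ δ δ>0
        in M ⊔ N , λ n ≤n → subst (_ <_) eq
             (dist-+ (seq x n) (seq x′ n) (seq y n) (seq y′ n)
               (c n (ℕₚ.m⊔n≤o⇒m≤o M N ≤n)) (d n (ℕₚ.m⊔n≤o⇒n≤o M N ≤n)))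
    ; *-cong = λ {x} {x′} {y} {y′} x≈ y≈ → mk≈ λ ε ε>0 →
        let A , A>0 , K , bx = bounded x
            B , B>0 , L , by = bounded y′
            δ , η , δ>0 , η>0 , eq = *-modulus A B ε A>0 B>0 ε>0
            M , c = close x≈ η η>0
            N , d = close y≈ δ δ>0
        in (K ⊔ L) ⊔ (M ⊔ N) , λ n ≤n →
           let n-KL = ℕₚ.m⊔n≤o⇒m≤o (K ⊔ L) (M ⊔ N) ≤n
               n-MN = ℕₚ.m⊔n≤o⇒n≤o (K ⊔ L) (M ⊔ N) ≤n
           in subst (_ <_) eq
             (dist-* (seq x n) (seq x′ n) (seq y n) (seq y′ n)
               (bx n (ℕₚ.m⊔n≤o⇒m≤o K L n-KL)) (by n (ℕₚ.m⊔n≤o⇒n≤o K L n-KL))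
               (c n (ℕₚ.m⊔n≤o⇒m≤o M N n-MN)) (d n (ℕₚ.m⊔n≤o⇒n≤o M N n-MN)))
    ; -‿cong = λ {x} {x′} x≈ → mk≈ λ ε ε>0 →
        let N , c = close x≈ ε ε>0
        in N , λ n N≤n → dist-neg (seq x n) (seq x′ n) (c n N≤n)
    ; +-assoc     = λ x y z → pointwise λ n → ℚₚ.+-assoc (seq x n) (seq y n) (seq z n)
    ; +-comm      = λ x y → pointwise λ n → ℚₚ.+-comm (seq x n) (seq y n)
    ; +-identityˡ = λ x → pointwise λ n → ℚₚ.+-identityˡ (seq x n)
    ; -‿inverseˡ  = λ x → pointwise λ n → ℚₚ.+-inverseˡ (seq x n)
    ; *-assoc     = λ x y z → pointwise λ n → ℚₚ.*-assoc (seq x n) (seq y n) (seq z n)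
    ; *-comm      = λ x y → pointwise λ n → ℚₚ.*-comm (seq x n) (seq y n)
    ; *-identityˡ = λ x → pointwise λ n → ℚₚ.*-identityˡ (seq x n)
    ; distribˡ    = λ x y z → pointwise λ n → ℚₚ.*-distribˡ-+ (seq x n) (seq y n) (seq z n)
    }

ℝ-ring : Ring
ℝ-ring = RingLaws.commutativeRing ℝ-laws

module _ where
  open Rat using (_<_; _≤_; _-_; _+_; _*_; -_)

  private
    0ʳ 1ʳ : ℝ
    0ʳ = const 0ℚ
    1ʳ = const 1ℚ

  null : ∀ {x} → (∀ ε → 0ℚ < ε → ∃[ N ] (∀ n → N ℕ.≤ n → ∣ seq x n ∣ < ε)) → x ≈ʳ 0ʳ
  null {x} small = mk≈ λ ε ε>0 →
    let N , s = small ε ε>0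
    in N , λ n N≤n → subst (λ d → ∣ d ∣ < ε) (≡-sym (p-0≡p (seq x n))) (s n N≤n)

  null⁻¹ : ∀ {x} → x ≈ʳ 0ʳ → ∀ ε → 0ℚ < ε → ∃[ N ] (∀ n → N ℕ.≤ n → ∣ seq x n ∣ < ε)
  null⁻¹ {x} x≈0 ε ε>0 =
    let N , c = close x≈0 ε ε>0
    in N , λ n N≤n → subst (λ d → ∣ d ∣ < ε) (p-0≡p (seq x n)) (c n N≤n)

  AwayFrom0 : ℝ → Set
  AwayFrom0 x = ∃[ δ ] 0ℚ < δ × ∃[ N ] (∀ n → N ℕ.≤ n → δ ≤ ∣ seq x n ∣)

  small-or-away : ∀ x ε → 0ℚ < ε →
    (∃[ N ] (∀ n → N ℕ.≤ n → ∣ seq x n ∣ < ε)) ⊎ AwayFrom0 x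
  small-or-away x ε ε>0 with halve ε ε>0
  ... | δ , δ>0 , δ+δ≡ε with halve δ δ>0
  ... | η , η>0 , η+η≡δ with cauchy x η η>0
  ... | N , cx with ∣ seq x N ∣ ℚₚ.<? δ
  ... | yes x<δ = inj₁ (N , λ n N≤n →
          subst (λ d → ∣ d ∣ < ε) (shift (seq x n) (seq x N))
            (subst (_ <_) δ+δ≡ε
              (∣+∣-< {seq x n - seq x N}
                (ℚₚ.<-trans (cx n N N≤n ℕₚ.≤-refl) η<δ) x<δ)))
    where
    η<δ : η < δ
    η<δ = subst₂ _<_ (ℚₚ.+-identityʳ η) η+η≡δ (ℚₚ.+-monoʳ-< η η>0)
  ... | no x≮δ = inj₂ (η , η>0 , N , λ n N≤n → ℚₚ.≮⇒≥ λ xₙ<η →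
          x≮δ (subst (λ d → ∣ d ∣ < δ) (shift (seq x N) (seq x n))
            (subst (_ <_) η+η≡δ
              (∣+∣-< {seq x N - seq x n} (cx N n ℕₚ.≤-refl N≤n) xₙ<η))))

  away⇒≉0 : ∀ {x} → AwayFrom0 x → ¬ x ≈ʳ 0ʳ
  away⇒≉0 (δ , δ>0 , M , away) x≈0 =
    let N , s = null⁻¹ x≈0 δ δ>0
        n = M ⊔ N
    in <⇒≱ (s n (ℕₚ.m≤n⊔m M N)) (away n (ℕₚ.m≤m⊔n M N))

  ℝ-isDomain : IsDomain ℝ-ring
  ℝ-isDomain = record
    { 1≉0 = away⇒≉0 (1ℚ , ℚₚ.positive⁻¹ 1ℚ , 0 , λ _ _ → ℚₚ.≤-refl)
    ; stable = λ x ¬¬x≈0 → null λ ε ε>0 → stable-at x ¬¬x≈0 (small-or-away x ε ε>0)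
    ; integral = λ x y x≉0 xy≈0 → null λ ε ε>0 →
        integral-at x y x≉0 xy≈0 (small-or-away y ε ε>0)
    }
    where
    stable-at : ∀ x {S : Set} → ¬ ¬ x ≈ʳ 0ʳ → S ⊎ AwayFrom0 x → S
    stable-at x _     (inj₁ s)    = s
    stable-at x ¬¬x≈0 (inj₂ away) = ⊥-elim (¬¬x≈0 (away⇒≉0 away))

    integral-at : ∀ x y {S : Set} → ¬ x ≈ʳ 0ʳ → (x *ʳ y) ≈ʳ 0ʳ → S ⊎ AwayFrom0 y → S
    integral-at x y _   _    (inj₁ s) = s
    integral-at x y x≉0 xy≈0 (inj₂ (δ , δ>0 , M , away)) = ⊥-elim (x≉0 (null λ ε ε>0 →
      let N , s = null⁻¹ xy≈0 (ε * δ) (*-pos ε>0 δ>0)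
      in M ⊔ N , λ n ≤n → ℚₚ.≰⇒> λ ε≤x → <⇒≱
        (subst (_< ε * δ) (ℚₚ.∣p*q∣≡∣p∣*∣q∣ (seq x n) (seq y n))
          (s n (ℕₚ.m⊔n≤o⇒n≤o M N ≤n)))
        (ℚₚ.≤-trans
          (ℚₚ.*-monoʳ-≤-nonNeg δ {{Rat.nonNegative (ℚₚ.<⇒≤ δ>0)}} ε≤x)
          (ℚₚ.*-monoˡ-≤-nonNeg ∣ seq x n ∣ {{ℚₚ.∣-∣-nonNeg (seq x n)}}
            (away n (ℕₚ.m⊔n≤o⇒m≤o M N ≤n))))))

  sum-of-squares : ∀ x y → x *ʳ x +ʳ y *ʳ y ≈ʳ 0ʳ → x ≈ʳ 0ʳ
  sum-of-squares x y x²+y²≈0 = null λ ε ε>0 →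
    let N , s = null⁻¹ x²+y²≈0 (ε * ε) (*-pos ε>0 ε>0)
    in N , λ n N≤n → ℚₚ.≰⇒> λ ε≤x → <⇒≱ (s n N≤n)
      (ℚₚ.≤-trans
        (ℚₚ.≤-trans
          (ℚₚ.*-monoʳ-≤-nonNeg ε {{Rat.nonNegative (ℚₚ.<⇒≤ ε>0)}} ε≤x)
          (ℚₚ.*-monoˡ-≤-nonNeg ∣ seq x n ∣ {{ℚₚ.∣-∣-nonNeg (seq x n)}} ε≤x))
        (squares (seq x n) (seq y n)))
    where
    0≤q² : ∀ q → 0ℚ ≤ q * q
    0≤q² q = subst (0ℚ ≤_) (≡-trans (ℚₚ.∣p*q∣≡∣p∣*∣q∣ q q) (∣p∣²≡p² q)) (ℚₚ.0≤∣p∣ (q * q))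
    squares : ∀ p q → ∣ p ∣ * ∣ p ∣ ≤ ∣ p * p + q * q ∣
    squares p q = subst₂ _≤_ (≡-trans (ℚₚ.+-identityʳ (p * p)) (≡-sym (∣p∣²≡p² p)))
      (≡-sym (ℚₚ.0≤p⇒∣p∣≡p (ℚₚ.+-mono-≤ (0≤q² p) (0≤q² q))))
      (ℚₚ.+-monoʳ-≤ (p * p) (0≤q² q))

------------------------------------------------------------------------
-- ℂ = ℝ[i]

module Adjoin-i (R : Ring) where
  open CommutativeRing R

  record R[i] : Set where
    no-eta-equality
    field re im : Carrier

  open R[i] public

  infix 4 _≈ᶜ_
  record _≈ᶜ_ (z w : R[i]) : Set where
    constructor _,_
    field
      re≈ : re z ≈ re w
      im≈ : im z ≈ im w

  open _≈ᶜ_ public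

  infixl 6 _+ᶜ_
  infixl 7 _*ᶜ_

  _+ᶜ_ _*ᶜ_ : R[i] → R[i] → R[i]
  (z +ᶜ w) .re = re z + re w
  (z +ᶜ w) .im = im z + im w
  (z *ᶜ w) .re = re z * re w - im z * im w
  (z *ᶜ w) .im = re z * im w + im z * re w

  -ᶜ_ : R[i] → R[i]
  (-ᶜ z) .re = - re z
  (-ᶜ z) .im = - im z

  0ᶜ 1ᶜ : R[i]
  0ᶜ .re = 0#
  0ᶜ .im = 0#
  1ᶜ .re = 1#
  1ᶜ .im = 0#

  open RingProperties ring using (-1*x≈-x; -0#≈0#)
  open SemiringSolver commutativeSemiring using (solve; _:=_; _:+_; _:*_)
  open SetoidReasoning setoid

  -- The semiring solver applies once subtraction is multiplication by μ.
  μ : Carrier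
  μ = - 1#

  minus : ∀ x y → x - y ≈ x + μ * y
  minus x y = +-congˡ (sym (-1*x≈-x y))

  assoc-re : ∀ a b c d e f →
    (a * c - b * d) * e - (a * d + b * c) * f ≈
    a * (c * e - d * f) - b * (c * f + d * e)
  assoc-re a b c d e f = begin
    (a * c - b * d) * e - (a * d + b * c) * f
      ≈⟨ trans (minus _ _) (+-congʳ (*-congʳ (minus _ _))) ⟩
    (a * c + μ * (b * d)) * e + μ * ((a * d + b * c) * f)
      ≈⟨ solve 7 (λ a b c d e f m →
           (a :* c :+ m :* (b :* d)) :* e :+ m :* ((a :* d :+ b :* c) :* f)
           := a :* (c :* e :+ m :* (d :* f)) :+ m :* (b :* (c :* f :+ d :* e)))
           refl a b c d e f μ ⟩
    a * (c * e + μ * (d * f)) + μ * (b * (c * f + d * e))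
      ≈⟨ trans (minus _ _) (+-congʳ (*-congˡ (minus _ _))) ⟨
    a * (c * e - d * f) - b * (c * f + d * e) ∎

  assoc-im : ∀ a b c d e f →
    (a * c - b * d) * f + (a * d + b * c) * e ≈
    a * (c * f + d * e) + b * (c * e - d * f)
  assoc-im a b c d e f = begin
    (a * c - b * d) * f + (a * d + b * c) * e
      ≈⟨ +-congʳ (*-congʳ (minus _ _)) ⟩
    (a * c + μ * (b * d)) * f + (a * d + b * c) * e
      ≈⟨ solve 7 (λ a b c d e f m →
           (a :* c :+ m :* (b :* d)) :* f :+ (a :* d :+ b :* c) :* e
           := a :* (c :* f :+ d :* e) :+ b :* (c :* e :+ m :* (d :* f)))
           refl a b c d e f μ ⟩
    a * (c * f + d * e) + b * (c * e + μ * (d * f))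
      ≈⟨ +-congˡ (*-congˡ (minus _ _)) ⟨
    a * (c * f + d * e) + b * (c * e - d * f) ∎

  distrib-re : ∀ a b c d e f →
    a * (c + e) - b * (d + f) ≈ (a * c - b * d) + (a * e - b * f)
  distrib-re a b c d e f = begin
    a * (c + e) - b * (d + f)
      ≈⟨ minus _ _ ⟩
    a * (c + e) + μ * (b * (d + f))
      ≈⟨ solve 7 (λ a b c d e f m →
           a :* (c :+ e) :+ m :* (b :* (d :+ f))
           := (a :* c :+ m :* (b :* d)) :+ (a :* e :+ m :* (b :* f)))
           refl a b c d e f μ ⟩
    (a * c + μ * (b * d)) + (a * e + μ * (b * f))
      ≈⟨ +-cong (minus _ _) (minus _ _) ⟨
    (a * c - b * d) + (a * e - b * f) ∎

  distrib-im : ∀ a b c d e f →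
    a * (d + f) + b * (c + e) ≈ (a * d + b * c) + (a * f + b * e)
  distrib-im = solve 6 (λ a b c d e f →
    a :* (d :+ f) :+ b :* (c :+ e) := (a :* d :+ b :* c) :+ (a :* f :+ b :* e)) refl

  comm-im : ∀ a b c d → a * d + b * c ≈ c * b + d * a
  comm-im = solve 4 (λ a b c d → a :* d :+ b :* c := c :* b :+ d :* a) refl

  1-re : ∀ a b → 1# * a - 0# * b ≈ a
  1-re a b = begin
    1# * a - 0# * b  ≈⟨ +-cong (*-identityˡ a) (-‿cong (zeroˡ b)) ⟩
    a - 0#           ≈⟨ +-congˡ -0#≈0# ⟩
    a + 0#           ≈⟨ +-identityʳ a ⟩
    a                ∎

  1-im : ∀ a b → 1# * b + 0# * a ≈ b
  1-im a b = begin
    1# * b + 0# * a  ≈⟨ +-cong (*-identityˡ b) (zeroˡ a) ⟩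
    b + 0#           ≈⟨ +-identityʳ b ⟩
    b                ∎

  1+μ : 1# + μ ≈ 0#
  1+μ = -‿inverseʳ 1#

  norm-re : ∀ a b c d → a * c - b * d ≈ 0# → a * d + b * c ≈ 0# →
            (a * a + b * b) * c ≈ 0#
  norm-re a b c d re≈0 im≈0 = begin
    (a * a + b * b) * c
      ≈⟨ +-identityʳ _ ⟨
    (a * a + b * b) * c + 0#
      ≈⟨ +-congˡ (trans (*-congʳ 1+μ) (zeroˡ _)) ⟨
    (a * a + b * b) * c + (1# + μ) * (a * (b * d))
      ≈⟨ +-congˡ (trans (distribʳ _ 1# μ) (+-congʳ (*-identityˡ _))) ⟩
    (a * a + b * b) * c + (a * (b * d) + μ * (a * (b * d)))
      ≈⟨ solve 5 (λ a b c d m →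
           (a :* a :+ b :* b) :* c :+ (a :* (b :* d) :+ m :* (a :* (b :* d)))
           := a :* (a :* c :+ m :* (b :* d)) :+ b :* (a :* d :+ b :* c))
           refl a b c d μ ⟩
    a * (a * c + μ * (b * d)) + b * (a * d + b * c)
      ≈⟨ +-cong (*-congˡ (trans (sym (minus _ _)) re≈0)) (*-congˡ im≈0) ⟩
    a * 0# + b * 0#
      ≈⟨ trans (+-cong (zeroʳ a) (zeroʳ b)) (+-identityˡ 0#) ⟩
    0# ∎

  norm-im : ∀ a b c d → a * c - b * d ≈ 0# → a * d + b * c ≈ 0# →
            (a * a + b * b) * d ≈ 0#
  norm-im a b c d re≈0 im≈0 = begin
    (a * a + b * b) * d
      ≈⟨ +-identityʳ _ ⟨
    (a * a + b * b) * d + 0#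
      ≈⟨ +-congˡ (trans (*-congʳ 1+μ) (zeroˡ _)) ⟨
    (a * a + b * b) * d + (1# + μ) * (b * (a * c) + μ * (b * (b * d)))
      ≈⟨ +-congˡ (trans (distribʳ _ 1# μ) (+-congʳ (*-identityˡ _))) ⟩
    (a * a + b * b) * d + ((b * (a * c) + μ * (b * (b * d)))
                          + μ * (b * (a * c) + μ * (b * (b * d))))
      ≈⟨ solve 5 (λ a b c d m →
           (a :* a :+ b :* b) :* d :+ ((b :* (a :* c) :+ m :* (b :* (b :* d)))
                          :+ m :* (b :* (a :* c) :+ m :* (b :* (b :* d))))
           := (a :* (a :* d :+ b :* c) :+ m :* (b :* (a :* c :+ m :* (b :* d))))
              :+ (b :* (b :* d) :+ m :* (b :* (b :* d))))
           refl a b c d μ ⟩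
    (a * (a * d + b * c) + μ * (b * (a * c + μ * (b * d))))
      + (b * (b * d) + μ * (b * (b * d)))
      ≈⟨ +-cong
           (+-cong (*-congˡ im≈0)
             (*-congˡ (*-congˡ (trans (sym (minus _ _)) re≈0))))
           (trans (+-congʳ (sym (*-identityˡ _)))
             (trans (sym (distribʳ _ 1# μ)) (trans (*-congʳ 1+μ) (zeroˡ _)))) ⟩
    (a * 0# + μ * (b * 0#)) + 0#
      ≈⟨ +-identityʳ _ ⟩
    a * 0# + μ * (b * 0#)
      ≈⟨ +-cong (zeroʳ a) (trans (*-congˡ (zeroʳ b)) (zeroʳ μ)) ⟩
    0# + 0#
      ≈⟨ +-identityˡ 0# ⟩
    0# ∎

  R[i]-laws : RingLaws _≈ᶜ_ _+ᶜ_ _*ᶜ_ -ᶜ_ 0ᶜ 1ᶜ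
  R[i]-laws = record
    { isEquivalence = record
      { refl  = refl , refl
      ; sym   = λ (p , q) → sym p , sym q
      ; trans = λ (p , q) (p′ , q′) → trans p p′ , trans q q′
      }
    ; +-cong = λ (p , q) (p′ , q′) → +-cong p p′ , +-cong q q′
    ; *-cong = λ (p , q) (p′ , q′) →
        +-cong (*-cong p p′) (-‿cong (*-cong q q′)) , +-cong (*-cong p q′) (*-cong q p′)
    ; -‿cong      = λ (p , q) → -‿cong p , -‿cong q
    ; +-assoc     = λ z w u → +-assoc (re z) (re w) (re u) , +-assoc (im z) (im w) (im u)
    ; +-comm      = λ z w → +-comm (re z) (re w) , +-comm (im z) (im w)
    ; +-identityˡ = λ z → +-identityˡ (re z) , +-identityˡ (im z)
    ; -‿inverseˡ  = λ z → -‿inverseˡ (re z) , -‿inverseˡ (im z)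
    ; *-assoc     = λ z w u →
        assoc-re (re z) (im z) (re w) (im w) (re u) (im u)
      , assoc-im (re z) (im z) (re w) (im w) (re u) (im u)
    ; *-comm      = λ z w →
        +-cong (*-comm (re z) (re w)) (-‿cong (*-comm (im z) (im w)))
      , comm-im (re z) (im z) (re w) (im w)
    ; *-identityˡ = λ z → 1-re (re z) (im z) , 1-im (re z) (im z)
    ; distribˡ    = λ z w u →
        distrib-re (re z) (im z) (re w) (im w) (re u) (im u)
      , distrib-im (re z) (im z) (re w) (im w) (re u) (im u)
    }

  R[i]-ring : Ring
  R[i]-ring = RingLaws.commutativeRing R[i]-laws

  R[i]-isDomain : IsDomain R → (∀ x y → x * x + y * y ≈ 0# → x ≈ 0#) →
                  IsDomain R[i]-ring
  R[i]-isDomain R-isDomain sum-of-squares = record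
    { 1≉0      = 1≉0 ∘ re≈
    ; stable   = λ z ¬¬z≈0 → stable (re z) (λ ≉ → ¬¬z≈0 (≉ ∘ re≈))
                           , stable (im z) (λ ≉ → ¬¬z≈0 (≉ ∘ im≈))
    ; integral = λ z w z≉0 (re≈0 , im≈0) →
        let norm≉0 : ¬ re z * re z + im z * im z ≈ 0#
            norm≉0 n≈0 = z≉0
              ( sum-of-squares (re z) (im z) n≈0
              , sum-of-squares (im z) (re z) (trans (+-comm _ _) n≈0))
        in integral _ (re w) norm≉0 (norm-re (re z) (im z) (re w) (im w) re≈0 im≈0)
         , integral _ (im w) norm≉0 (norm-im (re z) (im z) (re w) (im w) re≈0 im≈0)
    }
    where open IsDomain R-isDomain

ℂ-ring : Ring
ℂ-ring = Adjoin-i.R[i]-ring ℝ-ring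

ℂ-isDomain : IsDomain ℂ-ring
ℂ-isDomain = Adjoin-i.R[i]-isDomain ℝ-ring ℝ-isDomain sum-of-squares

------------------------------------------------------------------------
-- R[X]: lists of coefficients, constant term first, equal up to
-- trailing zeros

module Polynomial (R : Ring) where
  open CommutativeRing R

  Poly : Set
  Poly = List Carrier

  coeff : Poly → ℕ → Carrier
  coeff []      _       = 0#
  coeff (a ∷ p) zero    = a
  coeff (a ∷ p) (suc n) = coeff p n

  infix 4 _≈ᵖ_
  record _≈ᵖ_ (p q : Poly) : Set where
    constructor mk≈
    field coeff≈ : ∀ n → coeff p n ≈ coeff q n

  open _≈ᵖ_ public

  infixl 6 _+ᵖ_
  infixl 7 _*ᵖ_ _·_

  _+ᵖ_ : Poly → Poly → Poly
  []      +ᵖ q       = q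
  (a ∷ p) +ᵖ []      = a ∷ p
  (a ∷ p) +ᵖ (b ∷ q) = (a + b) ∷ (p +ᵖ q)

  -ᵖ_ : Poly → Poly
  -ᵖ_ = map (-_)

  _·_ : Carrier → Poly → Poly
  c · p = map (c *_) p

  _*ᵖ_ : Poly → Poly → Poly
  []      *ᵖ q = []
  (a ∷ p) *ᵖ q = a · q +ᵖ (0# ∷ (p *ᵖ q))

  C : Carrier → Poly
  C a = a ∷ []

  X : Poly
  X = 0# ∷ 1# ∷ []

  ≈ᵖ-isEquivalence : IsEquivalence _≈ᵖ_
  ≈ᵖ-isEquivalence = record
    { refl  = mk≈ λ _ → refl
    ; sym   = λ p≈q → mk≈ λ n → sym (coeff≈ p≈q n)
    ; trans = λ p≈q q≈r → mk≈ λ n → trans (coeff≈ p≈q n) (coeff≈ q≈r n)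
    }

  open IsEquivalence ≈ᵖ-isEquivalence using ()
    renaming (refl to reflᵖ; sym to symᵖ; trans to transᵖ)

  coeff-+ : ∀ p q n → coeff (p +ᵖ q) n ≈ coeff p n + coeff q n
  coeff-+ []      q       n       = sym (+-identityˡ _)
  coeff-+ (a ∷ p) []      n       = sym (+-identityʳ _)
  coeff-+ (a ∷ p) (b ∷ q) zero    = refl
  coeff-+ (a ∷ p) (b ∷ q) (suc n) = coeff-+ p q n

  coeff-neg : ∀ p n → coeff (-ᵖ p) n ≈ - coeff p n
  coeff-neg []      n       = sym (RingProperties.-0#≈0# ring)
  coeff-neg (a ∷ p) zero    = refl
  coeff-neg (a ∷ p) (suc n) = coeff-neg p n

  coeff-· : ∀ c p n → coeff (c · p) n ≈ c * coeff p n
  coeff-· c []      n       = sym (zeroʳ c)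
  coeff-· c (a ∷ p) zero    = refl
  coeff-· c (a ∷ p) (suc n) = coeff-· c p n

  module _ where
    open SetoidReasoning setoid

    +ᵖ-cong : ∀ {p p′ q q′} → p ≈ᵖ p′ → q ≈ᵖ q′ → p +ᵖ q ≈ᵖ p′ +ᵖ q′
    +ᵖ-cong {p} {p′} {q} {q′} p≈ q≈ = mk≈ λ n → begin
      coeff (p +ᵖ q) n          ≈⟨ coeff-+ p q n ⟩
      coeff p n + coeff q n     ≈⟨ +-cong (coeff≈ p≈ n) (coeff≈ q≈ n) ⟩
      coeff p′ n + coeff q′ n   ≈⟨ coeff-+ p′ q′ n ⟨
      coeff (p′ +ᵖ q′) n        ∎

    +ᵖ-assoc : ∀ p q r → (p +ᵖ q) +ᵖ r ≈ᵖ p +ᵖ (q +ᵖ r)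
    +ᵖ-assoc p q r = mk≈ λ n → begin
      coeff ((p +ᵖ q) +ᵖ r) n                ≈⟨ coeff-+ (p +ᵖ q) r n ⟩
      coeff (p +ᵖ q) n + coeff r n           ≈⟨ +-congʳ (coeff-+ p q n) ⟩
      (coeff p n + coeff q n) + coeff r n    ≈⟨ +-assoc _ _ _ ⟩
      coeff p n + (coeff q n + coeff r n)    ≈⟨ +-congˡ (coeff-+ q r n) ⟨
      coeff p n + coeff (q +ᵖ r) n           ≈⟨ coeff-+ p (q +ᵖ r) n ⟨
      coeff (p +ᵖ (q +ᵖ r)) n                ∎

    +ᵖ-comm : ∀ p q → p +ᵖ q ≈ᵖ q +ᵖ p
    +ᵖ-comm p q = mk≈ λ n → begin
      coeff (p +ᵖ q) n         ≈⟨ coeff-+ p q n ⟩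
      coeff p n + coeff q n    ≈⟨ +-comm _ _ ⟩
      coeff q n + coeff p n    ≈⟨ coeff-+ q p n ⟨
      coeff (q +ᵖ p) n         ∎

    -ᵖ-cong : ∀ {p q} → p ≈ᵖ q → -ᵖ p ≈ᵖ -ᵖ q
    -ᵖ-cong {p} {q} p≈q = mk≈ λ n → begin
      coeff (-ᵖ p) n  ≈⟨ coeff-neg p n ⟩
      - coeff p n     ≈⟨ -‿cong (coeff≈ p≈q n) ⟩
      - coeff q n     ≈⟨ coeff-neg q n ⟨
      coeff (-ᵖ q) n  ∎

    -ᵖ-inverseˡ : ∀ p → -ᵖ p +ᵖ p ≈ᵖ []
    -ᵖ-inverseˡ p = mk≈ λ n → begin
      coeff (-ᵖ p +ᵖ p) n           ≈⟨ coeff-+ (-ᵖ p) p n ⟩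
      coeff (-ᵖ p) n + coeff p n    ≈⟨ +-congʳ (coeff-neg p n) ⟩
      - coeff p n + coeff p n       ≈⟨ -‿inverseˡ _ ⟩
      0#                            ∎

    ·-cong : ∀ {c d p q} → c ≈ d → p ≈ᵖ q → c · p ≈ᵖ d · q
    ·-cong {c} {d} {p} {q} c≈d p≈q = mk≈ λ n → begin
      coeff (c · p) n  ≈⟨ coeff-· c p n ⟩
      c * coeff p n    ≈⟨ *-cong c≈d (coeff≈ p≈q n) ⟩
      d * coeff q n    ≈⟨ coeff-· d q n ⟨
      coeff (d · q) n  ∎

    ·-distrib-+ : ∀ c p q → c · (p +ᵖ q) ≈ᵖ c · p +ᵖ c · q
    ·-distrib-+ c p q = mk≈ λ n → begin
      coeff (c · (p +ᵖ q)) n               ≈⟨ coeff-· c (p +ᵖ q) n ⟩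
      c * coeff (p +ᵖ q) n                 ≈⟨ *-congˡ (coeff-+ p q n) ⟩
      c * (coeff p n + coeff q n)          ≈⟨ distribˡ c _ _ ⟩
      c * coeff p n + c * coeff q n        ≈⟨ +-cong (coeff-· c p n) (coeff-· c q n) ⟨
      coeff (c · p) n + coeff (c · q) n    ≈⟨ coeff-+ (c · p) (c · q) n ⟨
      coeff (c · p +ᵖ c · q) n             ∎

    ·-assoc : ∀ c d p → (c * d) · p ≈ᵖ c · (d · p)
    ·-assoc c d p = mk≈ λ n → begin
      coeff ((c * d) · p) n  ≈⟨ coeff-· (c * d) p n ⟩
      (c * d) * coeff p n    ≈⟨ *-assoc c d _ ⟩
      c * (d * coeff p n)    ≈⟨ *-congˡ (coeff-· d p n) ⟨
      c * coeff (d · p) n    ≈⟨ coeff-· c (d · p) n ⟨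
      coeff (c · (d · p)) n  ∎

    1· : ∀ p → 1# · p ≈ᵖ p
    1· p = mk≈ λ n → trans (coeff-· 1# p n) (*-identityˡ _)

    0· : ∀ {c} p → c ≈ 0# → c · p ≈ᵖ []
    0· {c} p c≈0 = mk≈ λ n →
      trans (coeff-· c p n) (trans (*-congʳ c≈0) (zeroˡ _))

  ∷-cong : ∀ {a b p q} → a ≈ b → p ≈ᵖ q → (a ∷ p) ≈ᵖ (b ∷ q)
  ∷-cong a≈b p≈q = mk≈ λ { zero → a≈b ; (suc n) → coeff≈ p≈q n }

  0∷[] : (0# ∷ []) ≈ᵖ []
  0∷[] = mk≈ λ { zero → refl ; (suc n) → refl }

  +ᵖ-identityʳ : ∀ p → p +ᵖ [] ≈ᵖ p
  +ᵖ-identityʳ p = +ᵖ-comm p []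

  polySetoid : Setoid 0ℓ 0ℓ
  polySetoid = record { isEquivalence = ≈ᵖ-isEquivalence }

  module _ where
    open SetoidReasoning polySetoid

    middleFour : ∀ p q r s → (p +ᵖ q) +ᵖ (r +ᵖ s) ≈ᵖ (p +ᵖ r) +ᵖ (q +ᵖ s)
    middleFour p q r s = begin
      (p +ᵖ q) +ᵖ (r +ᵖ s)    ≈⟨ +ᵖ-assoc p q (r +ᵖ s) ⟩
      p +ᵖ (q +ᵖ (r +ᵖ s))    ≈⟨ +ᵖ-cong {p} reflᵖ swap ⟩
      p +ᵖ (r +ᵖ (q +ᵖ s))    ≈⟨ +ᵖ-assoc p r (q +ᵖ s) ⟨
      (p +ᵖ r) +ᵖ (q +ᵖ s)    ∎
      where
      swap : q +ᵖ (r +ᵖ s) ≈ᵖ r +ᵖ (q +ᵖ s)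
      swap = begin
        q +ᵖ (r +ᵖ s)  ≈⟨ +ᵖ-assoc q r s ⟨
        (q +ᵖ r) +ᵖ s  ≈⟨ +ᵖ-cong {q +ᵖ r} {r +ᵖ q} {s} (+ᵖ-comm q r) reflᵖ ⟩
        (r +ᵖ q) +ᵖ s  ≈⟨ +ᵖ-assoc r q s ⟩
        r +ᵖ (q +ᵖ s)  ∎

    0∷-+ : ∀ p q → (0# ∷ (p +ᵖ q)) ≈ᵖ (0# ∷ p) +ᵖ (0# ∷ q)
    0∷-+ p q = ∷-cong (sym (+-identityˡ 0#)) reflᵖ

    *ᵖ-congˡ : ∀ p {q q′} → q ≈ᵖ q′ → p *ᵖ q ≈ᵖ p *ᵖ q′
    *ᵖ-congˡ []      q≈ = reflᵖ
    *ᵖ-congˡ (a ∷ p) q≈ = +ᵖ-cong (·-cong refl q≈) (∷-cong refl (*ᵖ-congˡ p q≈))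

    *ᵖ-zeroʳ : ∀ p → p *ᵖ [] ≈ᵖ []
    *ᵖ-zeroʳ []      = reflᵖ
    *ᵖ-zeroʳ (a ∷ p) = transᵖ (∷-cong refl (*ᵖ-zeroʳ p)) 0∷[]

    *ᵖ-∷ : ∀ p b q → p *ᵖ (b ∷ q) ≈ᵖ b · p +ᵖ (0# ∷ (p *ᵖ q))
    *ᵖ-∷ []      b q = symᵖ 0∷[]
    *ᵖ-∷ (a ∷ p) b q = ∷-cong (+-congʳ (*-comm a b)) (begin
      a · q +ᵖ p *ᵖ (b ∷ q)                    ≈⟨ +ᵖ-cong reflᵖ (*ᵖ-∷ p b q) ⟩
      a · q +ᵖ (b · p +ᵖ (0# ∷ (p *ᵖ q)))      ≈⟨ +ᵖ-assoc (a · q) (b · p) _ ⟨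
      (a · q +ᵖ b · p) +ᵖ (0# ∷ (p *ᵖ q))      ≈⟨ +ᵖ-cong (+ᵖ-comm (a · q) (b · p)) reflᵖ ⟩
      (b · p +ᵖ a · q) +ᵖ (0# ∷ (p *ᵖ q))      ≈⟨ +ᵖ-assoc (b · p) (a · q) _ ⟩
      b · p +ᵖ (a · q +ᵖ (0# ∷ (p *ᵖ q)))      ∎)

    *ᵖ-comm : ∀ p q → p *ᵖ q ≈ᵖ q *ᵖ p
    *ᵖ-comm []      q = symᵖ (*ᵖ-zeroʳ q)
    *ᵖ-comm (a ∷ p) q = begin
      a · q +ᵖ (0# ∷ (p *ᵖ q))  ≈⟨ +ᵖ-cong reflᵖ (∷-cong refl (*ᵖ-comm p q)) ⟩
      a · q +ᵖ (0# ∷ (q *ᵖ p))  ≈⟨ *ᵖ-∷ q a p ⟨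
      q *ᵖ (a ∷ p)              ∎

    *ᵖ-cong : ∀ {p p′ q q′} → p ≈ᵖ p′ → q ≈ᵖ q′ → p *ᵖ q ≈ᵖ p′ *ᵖ q′
    *ᵖ-cong {p} {p′} {q} {q′} p≈ q≈ = begin
      p *ᵖ q    ≈⟨ *ᵖ-congˡ p q≈ ⟩
      p *ᵖ q′   ≈⟨ *ᵖ-comm p q′ ⟩
      q′ *ᵖ p   ≈⟨ *ᵖ-congˡ q′ p≈ ⟩
      q′ *ᵖ p′  ≈⟨ *ᵖ-comm q′ p′ ⟩
      p′ *ᵖ q′  ∎

    *ᵖ-distribˡ : ∀ p q r → p *ᵖ (q +ᵖ r) ≈ᵖ p *ᵖ q +ᵖ p *ᵖ r
    *ᵖ-distribˡ []      q r = reflᵖ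
    *ᵖ-distribˡ (a ∷ p) q r = begin
      a · (q +ᵖ r) +ᵖ (0# ∷ (p *ᵖ (q +ᵖ r)))
        ≈⟨ +ᵖ-cong (·-distrib-+ a q r)
             (transᵖ (∷-cong refl (*ᵖ-distribˡ p q r)) (0∷-+ (p *ᵖ q) (p *ᵖ r))) ⟩
      (a · q +ᵖ a · r) +ᵖ ((0# ∷ (p *ᵖ q)) +ᵖ (0# ∷ (p *ᵖ r)))
        ≈⟨ middleFour (a · q) (a · r) _ _ ⟩
      (a · q +ᵖ (0# ∷ (p *ᵖ q))) +ᵖ (a · r +ᵖ (0# ∷ (p *ᵖ r))) ∎

    *ᵖ-distribʳ : ∀ r p q → (p +ᵖ q) *ᵖ r ≈ᵖ p *ᵖ r +ᵖ q *ᵖ r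
    *ᵖ-distribʳ r p q = begin
      (p +ᵖ q) *ᵖ r         ≈⟨ *ᵖ-comm (p +ᵖ q) r ⟩
      r *ᵖ (p +ᵖ q)         ≈⟨ *ᵖ-distribˡ r p q ⟩
      r *ᵖ p +ᵖ r *ᵖ q      ≈⟨ +ᵖ-cong (*ᵖ-comm r p) (*ᵖ-comm r q) ⟩
      p *ᵖ r +ᵖ q *ᵖ r      ∎

    ·-*ᵖ : ∀ a q r → (a · q) *ᵖ r ≈ᵖ a · (q *ᵖ r)
    ·-*ᵖ a []      r = reflᵖ
    ·-*ᵖ a (b ∷ q) r = begin
      (a * b) · r +ᵖ (0# ∷ ((a · q) *ᵖ r))
        ≈⟨ +ᵖ-cong (·-assoc a b r) (∷-cong (sym (zeroʳ a)) (·-*ᵖ a q r)) ⟩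
      a · (b · r) +ᵖ a · (0# ∷ (q *ᵖ r))
        ≈⟨ ·-distrib-+ a (b · r) (0# ∷ (q *ᵖ r)) ⟨
      a · (b · r +ᵖ (0# ∷ (q *ᵖ r))) ∎

    *ᵖ-assoc : ∀ p q r → (p *ᵖ q) *ᵖ r ≈ᵖ p *ᵖ (q *ᵖ r)
    *ᵖ-assoc []      q r = reflᵖ
    *ᵖ-assoc (a ∷ p) q r = begin
      (a · q +ᵖ (0# ∷ (p *ᵖ q))) *ᵖ r
        ≈⟨ *ᵖ-distribʳ r (a · q) (0# ∷ (p *ᵖ q)) ⟩
      (a · q) *ᵖ r +ᵖ (0# · r +ᵖ (0# ∷ ((p *ᵖ q) *ᵖ r)))
        ≈⟨ +ᵖ-cong (·-*ᵖ a q r) (+ᵖ-cong (0· r refl) (∷-cong refl (*ᵖ-assoc p q r))) ⟩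
      a · (q *ᵖ r) +ᵖ (0# ∷ (p *ᵖ (q *ᵖ r))) ∎

    *ᵖ-identityˡ : ∀ p → C 1# *ᵖ p ≈ᵖ p
    *ᵖ-identityˡ p = begin
      1# · p +ᵖ (0# ∷ [])  ≈⟨ +ᵖ-cong (1· p) 0∷[] ⟩
      p +ᵖ []              ≈⟨ +ᵖ-identityʳ p ⟩
      p                    ∎

  poly-laws : RingLaws _≈ᵖ_ _+ᵖ_ _*ᵖ_ -ᵖ_ [] (C 1#)
  poly-laws = record
    { isEquivalence = ≈ᵖ-isEquivalence
    ; +-cong = +ᵖ-cong ; *-cong = *ᵖ-cong ; -‿cong = -ᵖ-cong
    ; +-assoc = +ᵖ-assoc ; +-comm = +ᵖ-comm
    ; +-identityˡ = λ _ → reflᵖ ; -‿inverseˡ = -ᵖ-inverseˡ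
    ; *-assoc = *ᵖ-assoc ; *-comm = *ᵖ-comm
    ; *-identityˡ = *ᵖ-identityˡ ; distribˡ = *ᵖ-distribˡ
    }

  poly-ring : Ring
  poly-ring = RingLaws.commutativeRing poly-laws

  module _ (R-isDomain : IsDomain R) where
    open IsDomain R-isDomain

    private
      tail≈0 : ∀ {a p} → (a ∷ p) ≈ᵖ [] → p ≈ᵖ []
      tail≈0 ap≈0 = mk≈ λ n → coeff≈ ap≈0 (suc n)

      ∷≈0 : ∀ {a p} → a ≈ 0# → p ≈ᵖ [] → (a ∷ p) ≈ᵖ []
      ∷≈0 a≈0 p≈0 = transᵖ (∷-cong a≈0 p≈0) 0∷[]

      no-zero-divisors : ∀ p q → ¬ p ≈ᵖ [] → ¬ q ≈ᵖ [] → ¬ p *ᵖ q ≈ᵖ []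
      no-zero-divisors []      q       p≉0 q≉0 _ = p≉0 reflᵖ
      no-zero-divisors (a ∷ p) []      p≉0 q≉0 _ = q≉0 reflᵖ
      no-zero-divisors (a ∷ p) (b ∷ q) p≉0 q≉0 pq≈0 =
        let a≉0 : ¬ a ≈ 0#
            a≉0 a≈0 = no-zero-divisors p (b ∷ q) (λ p≈0 → p≉0 (∷≈0 a≈0 p≈0)) q≉0
              (tail≈0 (transᵖ (symᵖ (+ᵖ-cong (0· (b ∷ q) a≈0) reflᵖ)) pq≈0))
            b≈0 : b ≈ 0#
            b≈0 = integral a b a≉0
              (trans (sym (+-identityʳ (a * b))) (coeff≈ pq≈0 0))
        in
        no-zero-divisors (a ∷ p) q p≉0 (λ q≈0 → q≉0 (∷≈0 b≈0 q≈0))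
          (tail≈0 (transᵖ (symᵖ (+ᵖ-cong (0· (a ∷ p) b≈0) reflᵖ))
            (transᵖ (symᵖ (*ᵖ-∷ (a ∷ p) b q)) pq≈0)))
      stableᵖ : ∀ p → ¬ ¬ p ≈ᵖ [] → p ≈ᵖ []
      stableᵖ p ¬¬p≈0 = mk≈ λ n → stable (coeff p n) λ ≉ → ¬¬p≈0 λ p≈0 → ≉ (coeff≈ p≈0 n)

    poly-isDomain : IsDomain poly-ring
    poly-isDomain = record
      { 1≉0      = λ 1≈0 → 1≉0 (coeff≈ 1≈0 0)
      ; integral = λ p q p≉0 pq≈0 → stableᵖ q λ q≉0 → no-zero-divisors p q p≉0 q≉0 pq≈0
      ; stable   = stableᵖ
      }

module FractionField (D : Ring) (D-isDomain : IsDomain D) where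
  open CommutativeRing D
  open IsDomain D-isDomain
  open SemiringSolver commutativeSemiring using (solve; _:=_; _:+_; _:*_; con)
  open RingProperties ring 
    using (-‿distribˡ-*; -‿distribʳ-*)
    renaming (x∙y⁻¹≈ε⇒x≈y to x-y≈0⇒x≈y; x≈y⇒x∙y⁻¹≈ε to x≈y⇒x-y≈0)

  record Frac : Set where
    no-eta-equality
    field
      num   : Carrier
      den   : Carrier
      den≉0 : ¬ den ≈ 0#

  open Frac public

  infix 4 _≈ᶠ_
  record _≈ᶠ_ (f g : Frac) : Set where
    constructor mk≈
    field cross : num f * den g ≈ num g * den f

  open _≈ᶠ_ public

  infixl 6 _+ᶠ_
  infixl 7 _*ᶠ_

  fraction : (p q : Carrier) → ¬ q ≈ 0# → Frac
  fraction p q q≉0 .num   = p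
  fraction p q q≉0 .den   = q
  fraction p q q≉0 .den≉0 = q≉0

  _+ᶠ_ _*ᶠ_ : Frac → Frac → Frac
  (f +ᶠ g) .num   = num f * den g + num g * den f
  (f +ᶠ g) .den   = den f * den g
  (f +ᶠ g) .den≉0 = *-≉0 (den≉0 f) (den≉0 g)
  (f *ᶠ g) .num   = num f * num g
  (f *ᶠ g) .den   = den f * den g
  (f *ᶠ g) .den≉0 = *-≉0 (den≉0 f) (den≉0 g)

  -ᶠ_ : Frac → Frac
  (-ᶠ f) .num   = - num f
  (-ᶠ f) .den   = den f
  (-ᶠ f) .den≉0 = den≉0 f

  embed : Carrier → Frac
  embed p = fraction p 1# 1≉0

  private
    open SetoidReasoning setoid

    cancel : ∀ d p q → ¬ d ≈ 0# → d * p ≈ d * q → p ≈ q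
    cancel d p q d≉0 dp≈dq = x-y≈0⇒x≈y p q (integral d (p - q) d≉0 (begin
      d * (p - q)        ≈⟨ distribˡ d p (- q) ⟩
      d * p + d * - q    ≈⟨ +-congˡ (-‿distribʳ-* d q) ⟨
      d * p - d * q      ≈⟨ x≈y⇒x-y≈0 dp≈dq ⟩
      0#                 ∎))

    ≈ᶠ-trans : ∀ {f g h} → f ≈ᶠ g → g ≈ᶠ h → f ≈ᶠ h
    ≈ᶠ-trans {f} {g} {h} f≈g g≈h = mk≈ (cancel (den g) _ _ (den≉0 g) (begin
      den g * (num f * den h)
        ≈⟨ solve 3 (λ n d d′ → d :* (n :* d′) := (n :* d) :* d′) refl (num f) (den g) (den h) ⟩
      (num f * den g) * den h
        ≈⟨ *-congʳ (cross f≈g) ⟩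
      (num g * den f) * den h
        ≈⟨ solve 3 (λ n d d′ → (n :* d) :* d′ := (n :* d′) :* d) refl (num g) (den f) (den h) ⟩
      (num g * den h) * den f
        ≈⟨ *-congʳ (cross g≈h) ⟩
      (num h * den g) * den f
        ≈⟨ solve 3 (λ n d d′ → (n :* d) :* d′ := d :* (n :* d′)) refl (num h) (den g) (den f) ⟩
      den g * (num h * den f) ∎))

    +ᶠ-cong : ∀ {f f′ g g′} → f ≈ᶠ f′ → g ≈ᶠ g′ → f +ᶠ g ≈ᶠ f′ +ᶠ g′
    +ᶠ-cong {f} {f′} {g} {g′} f≈ g≈ = mk≈ (begin
      (num f * den g + num g * den f) * (den f′ * den g′)
        ≈⟨ solve 6 (λ a b c d b′ d′ → (a :* d :+ c :* b) :* (b′ :* d′)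
             := (a :* b′) :* (d :* d′) :+ (c :* d′) :* (b :* b′))
             refl (num f) (den f) (num g) (den g) (den f′) (den g′) ⟩
      (num f * den f′) * (den g * den g′) + (num g * den g′) * (den f * den f′)
        ≈⟨ +-cong (*-congʳ (cross f≈)) (*-congʳ (cross g≈)) ⟩
      (num f′ * den f) * (den g * den g′) + (num g′ * den g) * (den f * den f′)
        ≈⟨ solve 6 (λ a b c d b′ d′ →
             (a :* b′) :* (d′ :* d) :+ (c :* d′) :* (b′ :* b)
             := (a :* d :+ c :* b) :* (b′ :* d′))
             refl (num f′) (den f′) (num g′) (den g′) (den f) (den g) ⟩
      (num f′ * den g′ + num g′ * den f′) * (den f * den g) ∎)

    *ᶠ-cong : ∀ {f f′ g g′} → f ≈ᶠ f′ → g ≈ᶠ g′ → f *ᶠ g ≈ᶠ f′ *ᶠ g′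
    *ᶠ-cong {f} {f′} {g} {g′} f≈ g≈ = mk≈ (begin
      (num f * num g) * (den f′ * den g′)
        ≈⟨ exchange (num f) (num g) (den f′) (den g′) ⟩
      (num f * den f′) * (num g * den g′)
        ≈⟨ *-cong (cross f≈) (cross g≈) ⟩
      (num f′ * den f) * (num g′ * den g)
        ≈⟨ exchange (num f′) (num g′) (den f) (den g) ⟨
      (num f′ * num g′) * (den f * den g) ∎)
      where
      exchange : ∀ a b c d → (a * b) * (c * d) ≈ (a * c) * (b * d)
      exchange = solve 4 (λ a b c d →
        (a :* b) :* (c :* d) := (a :* c) :* (b :* d)) refl

  frac-laws : RingLaws _≈ᶠ_ _+ᶠ_ _*ᶠ_ -ᶠ_ (embed 0#) (embed 1#)
  frac-laws = record
    { isEquivalence = record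
      { refl = mk≈ refl ; sym = λ f≈g → mk≈ (sym (cross f≈g)) ; trans = ≈ᶠ-trans }
    ; +-cong = +ᶠ-cong
    ; *-cong = *ᶠ-cong
    ; -‿cong = λ {f} {g} f≈g → mk≈ (begin
        - num f * den g    ≈⟨ -‿distribˡ-* (num f) (den g) ⟨
        - (num f * den g)  ≈⟨ -‿cong (cross f≈g) ⟩
        - (num g * den f)  ≈⟨ -‿distribˡ-* (num g) (den f) ⟩
        - num g * den f    ∎)
    ; +-assoc = λ f g h → mk≈ (solve 6 (λ a b c d e f →
        ((a :* d :+ c :* b) :* f :+ e :* (b :* d)) :* (b :* (d :* f))
        := (a :* (d :* f) :+ (c :* f :+ e :* d) :* b) :* ((b :* d) :* f))
        refl (num f) (den f) (num g) (den g) (num h) (den h))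
    ; +-comm = λ f g → mk≈ (solve 4 (λ a b c d →
        (a :* d :+ c :* b) :* (d :* b) := (c :* b :+ a :* d) :* (b :* d))
        refl (num f) (den f) (num g) (den g))
    ; +-identityˡ = λ f → mk≈ (solve 2 (λ a b →
        (con 0 :* b :+ a :* con 1) :* b := a :* (con 1 :* b)) refl (num f) (den f))
    ; -‿inverseˡ = λ f → mk≈ (begin
        (- num f * den f + num f * den f) * 1#
          ≈⟨ *-congʳ (distribʳ (den f) (- num f) (num f)) ⟨
        (- num f + num f) * den f * 1#
          ≈⟨ *-congʳ (trans (*-congʳ (-‿inverseˡ (num f))) (zeroˡ (den f))) ⟩
        0# * 1#
          ≈⟨ trans (zeroˡ 1#) (sym (zeroˡ (den f * den f))) ⟩
        0# * (den f * den f) ∎)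
    ; *-assoc = λ f g h → mk≈ (solve 6 (λ a b c d e f →
        ((a :* c) :* e) :* (b :* (d :* f)) := (a :* (c :* e)) :* ((b :* d) :* f))
        refl (num f) (den f) (num g) (den g) (num h) (den h))
    ; *-comm = λ f g → mk≈ (solve 4 (λ a b c d →
        (a :* c) :* (d :* b) := (c :* a) :* (b :* d))
        refl (num f) (den f) (num g) (den g))
    ; *-identityˡ = λ f → mk≈ (solve 2 (λ a b →
        (con 1 :* a) :* b := a :* (con 1 :* b)) refl (num f) (den f))
    ; distribˡ = λ f g h → mk≈ (solve 6 (λ a b c d e f →
        (a :* (c :* f :+ e :* d)) :* ((b :* d) :* (b :* f))
        := ((a :* c) :* (b :* f) :+ (a :* e) :* (b :* d)) :* (b :* (d :* f)))
        refl (num f) (den f) (num g) (den g) (num h) (den h))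
    }

  frac-ring : Ring
  frac-ring = RingLaws.commutativeRing frac-laws

------------------------------------------------------------------------
-- The field ℂ(x,y) of rational functions, as Frac(ℂ[x][y])

module ℂ[x]   = Polynomial ℂ-ring
module ℂ[x,y] = Polynomial ℂ[x].poly-ring

ℂ[x]-isDomain : IsDomain ℂ[x].poly-ring
ℂ[x]-isDomain = ℂ[x].poly-isDomain ℂ-isDomain

ℂ[x,y]-isDomain : IsDomain ℂ[x,y].poly-ring
ℂ[x,y]-isDomain = ℂ[x,y].poly-isDomain ℂ[x]-isDomain

module RationalFunctions = FractionField ℂ[x,y].poly-ring ℂ[x,y]-isDomain

x y : ℂ[x,y].Poly
x = ℂ[x,y].C ℂ[x].X
y = ℂ[x,y].X

module Fibonacci (R : Ring) (x y : CommutativeRing.Carrier R) where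
  open CommutativeRing R

  fib : ℕ → Carrier
  fib zero          = 0#
  fib (suc zero)    = 1#
  fib (suc (suc n)) = x * fib (suc n) + y * fib n

module Fibonacci≉0 (R : Ring) (R-isDomain : IsDomain R) where
  open CommutativeRing R
  open IsDomain R-isDomain
  open Polynomial R
  open SetoidReasoning setoid

  module _ (a : Carrier) (a≉0 : ¬ a ≈ 0#) where
    open Fibonacci poly-ring (C a) X

    coeff₀-fib : ∀ n → coeff (fib (suc (suc n))) 0 ≈ a * coeff (fib (suc n)) 0
    coeff₀-fib n = begin
      coeff (C a *ᵖ f +ᵖ X *ᵖ g) 0
        ≈⟨ coeff-+ (C a *ᵖ f) (X *ᵖ g) 0 ⟩
      coeff (C a *ᵖ f) 0 + coeff (X *ᵖ g) 0
        ≈⟨ +-cong (coeff-+ (a · f) _ 0) (coeff-+ (0# · g) _ 0) ⟩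
      (coeff (a · f) 0 + 0#) + (coeff (0# · g) 0 + 0#)
        ≈⟨ +-cong (+-identityʳ _) (+-identityʳ _) ⟩
      coeff (a · f) 0 + coeff (0# · g) 0
        ≈⟨ +-cong (coeff-· a f 0) (coeff≈ (0· g refl) 0) ⟩
      a * coeff f 0 + 0#
        ≈⟨ +-identityʳ _ ⟩
      a * coeff f 0 ∎
      where
      f g : Poly
      f = fib (suc n)
      g = fib n

    coeff₀-fib≉0 : ∀ n → ¬ coeff (fib (suc n)) 0 ≈ 0#
    coeff₀-fib≉0 zero    = 1≉0
    coeff₀-fib≉0 (suc n) ≈0 =
      *-≉0 a≉0 (coeff₀-fib≉0 n) (trans (sym (coeff₀-fib n)) ≈0)

    fib≉0 : ∀ n .{{_ : ℕ.NonZero n}} → ¬ fib n ≈ᵖ []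
    fib≉0 (suc n) fib≈0 = coeff₀-fib≉0 n (coeff≈ fib≈0 0)

F : ℕ → ℂ[x,y].Poly
F = Fibonacci.fib ℂ[x,y].poly-ring x y

F≉0 : ∀ n .{{_ : ℕ.NonZero n}} → ¬ F n ℂ[x,y].≈ᵖ []
F≉0 = Fibonacci≉0.fib≉0 ℂ[x].poly-ring ℂ[x]-isDomain ℂ[x].X
  λ X≈0 → IsDomain.1≉0 ℂ-isDomain (ℂ[x].coeff≈ X≈0 1)

module _ where
  open CommutativeRing ℂ[x,y].poly-ring
  open RawSemiringDefs (Semiring.rawSemiring semiring) using (product)
  open IsDomain ℂ[x,y]-isDomain

  product≉0 : ∀ k (f : Vector Carrier k) → (∀ i → ¬ f i ≈ 0#) → ¬ product f ≈ 0#
  product≉0 zero    f f≉0 = 1≉0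
  product≉0 (suc k) f f≉0 =
    *-≉0 (f≉0 Fin.zero) (product≉0 k (f ∘ Fin.suc) (f≉0 ∘ Fin.suc))

  -- The s-Fibopolynomial n over k.  When k > n, truncated subtraction turns
  -- every factor with n - i ≤ 0, of which i = n is one, into F 0 = 0, so that
  -- the quotient vanishes.
  fibopolynomial : (s : ℕ) .{{_ : ℕ.NonZero s}} → ℕ → ℕ → RationalFunctions.Frac
  fibopolynomial s n k = RationalFunctions.fraction
    (product {k} λ i → F (s ℕ.* (n ℕ.∸ toℕ i)))
    (product {k} λ i → F (s ℕ.* suc (toℕ i)))
    (product≉0 k _ λ i → F≉0 (s ℕ.* suc (toℕ i)) {{ℕₚ.m*n≢0 s (suc (toℕ i))}})

ℂ⟨x,y⟩ : Set
ℂ⟨x,y⟩ = RationalFunctions.Frac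

open RationalFunctions public using (embed)
open CommutativeRing RationalFunctions.frac-ring public using (_≈_; _+_; _*_; -_; 1#)
open RawSemiringDefs
  (Semiring.rawSemiring (CommutativeRing.semiring RationalFunctions.frac-ring)) public
  using (sum; product; _^_)

sum≤ : ℕ → (ℕ → ℂ⟨x,y⟩) → ℂ⟨x,y⟩
sum≤ n f = sum {suc n} λ i → f (toℕ i)

-- As y is invertible in ℂ(x,y), such a sequence is determined by G 0 and
-- G 1, which are arbitrary.
IsGibonacci : (ℤ → ℂ⟨x,y⟩) → Set
IsGibonacci G = ∀ n →
  G n ≈ embed x * G (n ℤ.- ℤ.+ 1) + embed y * G (n ℤ.- ℤ.+ 2)

sumℕ : ∀ {n} → Vector ℕ n → ℕ
sumℕ = foldr ℕ._+_ 0

{-# OPTIONS --safe #-}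

-- Let α, β be the roots of T² = x T + y.  Products of K factors G(sn + m) are
-- combinations of the sequences (αˢⁱ βˢ⁽ᴷ⁻ⁱ⁾)ⁿ, hence annihilated by
-- D(z) = Π_{0≤i≤K} (1 - αˢⁱ βˢ⁽ᴷ⁻ⁱ⁾ z), whose coefficients are the
-- s-Fibopolynomials (K+1 over j) up to sign and a power of y, while
-- 1/D(z) = Σₙ (n+K over K) zⁿ.  The identity is a = (D a) · (1/D) for the
-- generating function a, where D a is a polynomial of degree ≤ K.
-- Roots are avoided: by Vajda's identity, multiplying a sequence by G(sn + m)
-- raises the order of D by one, and the same step inverts D by induction on K.
-- Factors G(stn + m) reduce to products of t factors by the addition formula.

module Submission where

open import Algebra.Bundles using (CommutativeRing; CommutativeSemiring; Semiring)
import Algebra.Properties.CommutativeSemiring.Exp as CommutativeExp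
import Algebra.Properties.Monoid.Sum as MonoidSum
import Algebra.Properties.Ring as RingProperties
import Algebra.Properties.Semiring.Exp as Exp
import Algebra.Properties.Semiring.Sum as Sum
import Algebra.Definitions.RawSemiring as RawSemiringDefs
import Algebra.Solver.Ring.NaturalCoefficients.Default as SemiringSolver
open import Data.Fin.Base as Fin using (toℕ)
open import Data.Fin.Properties using (toℕ≤pred[n]; toℕ<n)
open import Data.Integer.Base as ℤ using (ℤ)
import Data.Integer.Properties as ℤₚ
import Data.Integer.Solver as ℤ-Solver
open import Data.Nat.Base as ℕ using (ℕ; zero; suc; _∸_; _/_; _≤_; _<_; z≤n; s≤s)
import Data.Nat.Divisibility as ℕ∣
import Data.Nat.DivMod as DivMod
import Data.Nat.Properties as ℕₚ
import Data.Nat.Solver as ℕ-Solver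
open import Data.Sum.Base using (inj₁; inj₂)
open import Data.Vec.Functional using (Vector; foldr)
open import Defs using (Ring; IsDomain; module FractionField; module RationalFunctions; module ℂ[x,y]; ℂ[x,y]-isDomain; F; F≉0; fibopolynomial)
open import Function.Base using (_∘_)
import Relation.Binary.Reasoning.Setoid as SetoidReasoning
open import Relation.Binary.PropositionalEquality.Core as ≡ using (_≡_)
open import Relation.Nullary using (¬_)

-- Convolution of sequences

module Convolution {c ℓ} (S : CommutativeSemiring c ℓ) where
  open CommutativeSemiring S
  open Sum semiring
  open SetoidReasoning setoid
  open SemiringSolver S using (solve; _:=_; _:+_; _:*_)

  ∑≤ : ℕ → (ℕ → Carrier) → Carrier
  ∑≤ n f = sum {suc n} λ i → f (toℕ i)

  ∑≤-cong : ∀ n f g → (∀ i → i ≤ n → f i ≈ g i) → ∑≤ n f ≈ ∑≤ n g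
  ∑≤-cong n f g f≈g = sum-cong-≋ {suc n} λ i → f≈g (toℕ i) (toℕ≤pred[n] i)

  ∑≤-+ : ∀ n f g → ∑≤ n (λ i → f i + g i) ≈ ∑≤ n f + ∑≤ n g
  ∑≤-+ n f g = ∑-distrib-+ {suc n} (f ∘ toℕ) (g ∘ toℕ)

  ∑≤-*ˡ : ∀ n a f → a * ∑≤ n f ≈ ∑≤ n (λ i → a * f i)
  ∑≤-*ˡ n a f = *-distribˡ-sum {suc n} a (f ∘ toℕ)

  ∑≤-*ʳ : ∀ n a f → ∑≤ n f * a ≈ ∑≤ n (λ i → f i * a)
  ∑≤-*ʳ n a f = *-distribʳ-sum {suc n} a (f ∘ toℕ)

  ∑≤-extend : ∀ m d f → (∀ i → m < i → i ≤ m ℕ.+ d → f i ≈ 0#) →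
              ∑≤ (m ℕ.+ d) f ≈ ∑≤ m f
  ∑≤-extend zero    d f f≈0 = +-congˡ (trans
    (sum-cong-≋ {d} λ i → f≈0 (suc (toℕ i)) (s≤s z≤n) (toℕ<n i))
    (sum-replicate-zero d))
  ∑≤-extend (suc m) d f f≈0 = +-congˡ
    (∑≤-extend m d (f ∘ suc) λ i m<i i≤m+d → f≈0 (suc i) (s≤s m<i) (s≤s i≤m+d))

  infixl 7 _⋆_
  -- Sequences stand for formal power series, and this is their Cauchy product; `δ` below is the
  -- series 1.
  _⋆_ : (ℕ → Carrier) → (ℕ → Carrier) → ℕ → Carrier
  (f ⋆ g) n = ∑≤ n λ i → f i * g (n ∸ i)

  δ : ℕ → Carrier
  δ zero    = 1#
  δ (suc _) = 0#

  ⋆-congˡ : ∀ f {g g′} → (∀ n → g n ≈ g′ n) → ∀ n → (f ⋆ g) n ≈ (f ⋆ g′) n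
  ⋆-congˡ f g≈g′ n = ∑≤-cong n _ _ λ i _ → *-congˡ {f i} (g≈g′ (n ∸ i))

  ⋆-congʳ : ∀ {f f′} g → (∀ n → f n ≈ f′ n) → ∀ n → (f ⋆ g) n ≈ (f′ ⋆ g) n
  ⋆-congʳ g f≈f′ n = ∑≤-cong n _ _ λ i _ → *-congʳ {g (n ∸ i)} (f≈f′ i)

  ⋆-+ : ∀ f g h n → (f ⋆ (λ i → g i + h i)) n ≈ (f ⋆ g) n + (f ⋆ h) n
  ⋆-+ f g h n = trans
    (∑≤-cong n _ _ λ i _ → distribˡ (f i) (g (n ∸ i)) (h (n ∸ i)))
    (∑≤-+ n (λ i → f i * g (n ∸ i)) (λ i → f i * h (n ∸ i)))

  ⋆-* : ∀ a f g n → (f ⋆ (λ i → a * g i)) n ≈ a * (f ⋆ g) n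
  ⋆-* a f g n = trans
    (∑≤-cong n _ _ λ i _ → solve 3 (λ a f g → f :* (a :* g) := a :* (f :* g)) refl a (f i) (g (n ∸ i)))
    (sym (∑≤-*ˡ n a λ i → f i * g (n ∸ i)))

  -- The sum unfolds at its first term; commutativity needs the last term split off as well.
  ⋆-suc : ∀ f g n → (f ⋆ g) (suc n) ≈ (f ⋆ (g ∘ suc)) n + f (suc n) * g 0
  ⋆-suc f g zero    = solve 3 (λ a b z → a :+ (b :+ z) := (a :+ z) :+ b) refl _ _ 0#
  ⋆-suc f g (suc n) = trans (+-congˡ (⋆-suc (f ∘ suc) g n)) (sym (+-assoc _ _ _))

  ⋆-comm : ∀ f g n → (f ⋆ g) n ≈ (g ⋆ f) n
  ⋆-comm f g zero    = +-congʳ (*-comm (f 0) (g 0))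
  ⋆-comm f g (suc n) = begin
    f 0 * g (suc n) + ((f ∘ suc) ⋆ g) n  ≈⟨ +-cong (*-comm _ _) (⋆-comm (f ∘ suc) g n) ⟩
    g (suc n) * f 0 + (g ⋆ (f ∘ suc)) n  ≈⟨ +-comm _ _ ⟩
    (g ⋆ (f ∘ suc)) n + g (suc n) * f 0  ≈⟨ ⋆-suc g f n ⟨
    (g ⋆ f) (suc n)                      ∎

  -- Induction on n with `f` replaced by its tail: the tail of `f ⋆ g` is, by unfolding, `f 0` times
  -- the tail of `g` plus the tail of `f` convolved with `g`.
  ⋆-assoc : ∀ f g h n → ((f ⋆ g) ⋆ h) n ≈ (f ⋆ (g ⋆ h)) n
  ⋆-assoc f g h zero    = begin
    (f 0 * g 0 + 0#) * h 0 + 0#    ≈⟨ +-congʳ (*-congʳ (+-identityʳ _)) ⟩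
    f 0 * g 0 * h 0 + 0#           ≈⟨ +-congʳ (*-assoc _ _ _) ⟩
    f 0 * (g 0 * h 0) + 0#         ≈⟨ +-congʳ (*-congˡ (+-identityʳ _)) ⟨
    f 0 * (g 0 * h 0 + 0#) + 0#    ∎
  ⋆-assoc f g h (suc n) = begin
    (f 0 * g 0 + 0#) * h (suc n) + ((λ i → f 0 * g (suc i) + ((f ∘ suc) ⋆ g) i) ⋆ h) n
      ≈⟨ +-cong (*-congʳ (+-identityʳ _)) (linear n) ⟩
    f 0 * g 0 * h (suc n) + (f 0 * ((g ∘ suc) ⋆ h) n + (((f ∘ suc) ⋆ g) ⋆ h) n)
      ≈⟨ +-congˡ (+-congˡ (⋆-assoc (f ∘ suc) g h n)) ⟩
    f 0 * g 0 * h (suc n) + (f 0 * ((g ∘ suc) ⋆ h) n + ((f ∘ suc) ⋆ (g ⋆ h)) n)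
      ≈⟨ solve 5 (λ a b c d e → a :* b :* c :+ (a :* d :+ e) := a :* (b :* c :+ d) :+ e)
           refl _ _ _ _ _ ⟩
    f 0 * (g 0 * h (suc n) + ((g ∘ suc) ⋆ h) n) + ((f ∘ suc) ⋆ (g ⋆ h)) n ∎
    where
    linear : ∀ n → ((λ i → f 0 * g (suc i) + ((f ∘ suc) ⋆ g) i) ⋆ h) n
                 ≈ f 0 * ((g ∘ suc) ⋆ h) n + (((f ∘ suc) ⋆ g) ⋆ h) n
    linear n = begin
      ((λ i → f 0 * g (suc i) + ((f ∘ suc) ⋆ g) i) ⋆ h) n
        ≈⟨ ⋆-comm (λ i → f 0 * g (suc i) + ((f ∘ suc) ⋆ g) i) h n ⟩
      (h ⋆ (λ i → f 0 * g (suc i) + ((f ∘ suc) ⋆ g) i)) n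
        ≈⟨ ⋆-+ h (λ i → f 0 * g (suc i)) ((f ∘ suc) ⋆ g) n ⟩
      (h ⋆ (λ i → f 0 * g (suc i))) n + (h ⋆ ((f ∘ suc) ⋆ g)) n
        ≈⟨ +-cong (⋆-* (f 0) h (g ∘ suc) n) (⋆-comm h ((f ∘ suc) ⋆ g) n) ⟩
      f 0 * (h ⋆ (g ∘ suc)) n + (((f ∘ suc) ⋆ g) ⋆ h) n
        ≈⟨ +-congʳ (*-congˡ (⋆-comm h (g ∘ suc) n)) ⟩
      f 0 * ((g ∘ suc) ⋆ h) n + (((f ∘ suc) ⋆ g) ⋆ h) n ∎

  ⋆-identityˡ : ∀ f n → (δ ⋆ f) n ≈ f n
  ⋆-identityˡ f zero    = trans (+-identityʳ _) (*-identityˡ _)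
  ⋆-identityˡ f (suc n) = trans
    (+-cong (*-identityˡ _) (trans (sum-cong-≋ {suc n} λ i → zeroˡ (f (n ∸ toℕ i))) (sum-replicate-zero (suc n))))
    (+-identityʳ _)

-- The exponents of -1 and y

module Exponents (s : ℕ) where
  open ℕ-Solver.+-*-Solver using (solve; _:=_; _:+_; _:*_; con)

  -- Both numerators are even, so the division is exact. At j = 0 the truncated `j ∸ 1` is harmless
  -- because of the factor j.
  sign-exponent y-exponent : ℕ → ℕ
  sign-exponent j = (s ℕ.* j ℕ.+ 2 ℕ.* (s ℕ.+ 1)) ℕ.* (j ℕ.+ 1) / 2
  y-exponent    j = s ℕ.* j ℕ.* (j ∸ 1) / 2

  -- Holds for either parity of m, so the recursions below need no evenness proof.
  [m+n*2]/2 : ∀ {l} m n → l ≡ m ℕ.+ n ℕ.* 2 → l / 2 ≡ m / 2 ℕ.+ n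
  [m+n*2]/2 m n ≡.refl = ≡.trans (DivMod.+-distrib-/-∣ʳ m (ℕ∣.divides n ≡.refl))
    (≡.cong (m / 2 ℕ.+_) (DivMod.m*n/n≡m n 2))

  sign-exponent-zero : sign-exponent 0 ≡ s ℕ.+ 1
  sign-exponent-zero = [m+n*2]/2 0 (s ℕ.+ 1) (solve 1 (λ s →
    (s :* con 0 :+ con 2 :* (s :+ con 1)) :* con 1 := (s :+ con 1) :* con 2) ≡.refl s)

  y-exponent-zero : y-exponent 0 ≡ 0
  y-exponent-zero = ≡.cong (_/ 2) (ℕₚ.*-zeroʳ (s ℕ.* 0))

  -- Modulo 2 the increment is s j + 1, which gives the sign of the factor `- (q ^ j)` in the
  -- recursion for `d`.
  sign-exponent-suc : ∀ j → sign-exponent (suc j) ≡ sign-exponent j ℕ.+ (s ℕ.* j ℕ.+ (s ℕ.+ s ℕ.+ 1))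
  sign-exponent-suc j = [m+n*2]/2 ((s ℕ.* j ℕ.+ 2 ℕ.* (s ℕ.+ 1)) ℕ.* (j ℕ.+ 1)) _ (solve 2 (λ s j →
    (s :* (con 1 :+ j) :+ con 2 :* (s :+ con 1)) :* ((con 1 :+ j) :+ con 1)
    := (s :* j :+ con 2 :* (s :+ con 1)) :* (j :+ con 1) :+ (s :* j :+ (s :+ s :+ con 1)) :* con 2)
    ≡.refl s j)

  y-exponent-suc : ∀ j → y-exponent (suc j) ≡ y-exponent j ℕ.+ s ℕ.* j
  y-exponent-suc j = [m+n*2]/2 (s ℕ.* j ℕ.* (j ∸ 1)) (s ℕ.* j) (numerator j)
    where
    numerator : ∀ j → s ℕ.* suc j ℕ.* j ≡ s ℕ.* j ℕ.* (j ∸ 1) ℕ.+ s ℕ.* j ℕ.* 2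
    -- The case split serves to evaluate `j ∸ 1`.
    numerator zero    = solve 1 (λ s → s :* con 1 :* con 0
      := s :* con 0 :* con 0 :+ s :* con 0 :* con 2) ≡.refl s
    numerator (suc j) = solve 2 (λ s j → s :* (con 2 :+ j) :* (con 1 :+ j)
      := s :* (con 1 :+ j) :* j :+ s :* (con 1 :+ j) :* con 2) ≡.refl s j

-- Expansion in fibonomial coefficients over a commutative ring

module Fibonomial {c ℓ} (R : CommutativeRing c ℓ) where
  open CommutativeRing R

  -- The coefficients `B` enter only through boundary values and two absorption rules; division by F
  -- (s (n + 1)) is replaced by cancellation.
  module Expansion
    (x y : Carrier) (s : ℕ)
    (F : ℕ → Carrier) (F[0] : F 0 ≈ 0#) (F[1] : F 1 ≈ 1#)
    (F-rec : ∀ p → F (suc (suc p)) ≈ x * F (suc p) + y * F p)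
    (cancel : ∀ n {a b} → F (s ℕ.* suc n) * a ≈ F (s ℕ.* suc n) * b → a ≈ b)
    (B : ℕ → ℕ → Carrier)
    (B[n,0]   : ∀ n → B n 0 ≈ 1#)
    (B[n,k]≈0 : ∀ {n k} → n < k → B n k ≈ 0#)
    (absorb   : ∀ n k → F (s ℕ.* suc n) * B n k ≈ F (s ℕ.* suc k) * B (suc n) (suc k))
    (absorb′  : ∀ n k → F (s ℕ.* suc n) * B n k ≈ F (s ℕ.* (suc n ∸ k)) * B (suc n) k)
    where

    open Convolution commutativeSemiring
    open Exponents s
    open RawSemiringDefs (Semiring.rawSemiring semiring) using (_^_; product)
    open Exp semiring using (^-congˡ; ^-homo-*; ^-assocʳ)
    open CommutativeExp commutativeSemiring using (^-distrib-*)
    open RingProperties ring using (-‿distribˡ-*; -‿involutive; -1*x≈-x)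
    open SemiringSolver commutativeSemiring using (solve; _:=_; _:+_; _:*_; con)
    open SetoidReasoning setoid

    ≡⇒≈ : ∀ {a b} → a ≡ b → a ≈ b
    ≡⇒≈ ≡.refl = refl

    -- Recurrent sequences and Vajda's identity

    Recurrent : (ℕ → Carrier) → Set ℓ
    Recurrent g = ∀ p → g (suc (suc p)) ≈ x * g (suc p) + y * g p

    -- E n stands for y F₍ₙ₋₁₎, with E 0 = y F₋₁ = 1.
    E : ℕ → Carrier
    E zero    = 1#
    E (suc n) = y * F n

    E-rec : Recurrent E
    E-rec zero = begin
      y * F 1                 ≈⟨ *-congˡ F[1] ⟩
      y * 1#                  ≈⟨ solve 2 (λ x y → y :* con 1 := x :* (y :* con 0) :+ y :* con 1) refl x y ⟩
      x * (y * 0#) + y * 1#   ≈⟨ +-congʳ (*-congˡ (*-congˡ F[0])) ⟨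
      x * (y * F 0) + y * 1#  ∎
    E-rec (suc p) = begin
      y * F (suc (suc p))                ≈⟨ *-congˡ (F-rec p) ⟩
      y * (x * F (suc p) + y * F p)      ≈⟨ solve 4 (λ x y a b → y :* (x :* a :+ y :* b) := x :* (y :* a) :+ y :* (y :* b)) refl x y _ _ ⟩
      x * (y * F (suc p)) + y * (y * F p) ∎

    -- As functions of j both sides satisfy the recurrence, and they agree at j = 0 and j = 1.
    addition : ∀ {g} → Recurrent g → ∀ j p → g (j ℕ.+ p) ≈ E j * g p + F j * g (suc p)
    addition {g} g-rec zero p = begin
      g p                          ≈⟨ solve 2 (λ a b → a := con 1 :* a :+ con 0 :* b) refl _ _ ⟩
      1# * g p + 0# * g (suc p)    ≈⟨ +-congˡ (*-congʳ F[0]) ⟨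
      1# * g p + F 0 * g (suc p)   ∎
    addition {g} g-rec (suc zero) p = begin
      g (suc p)                         ≈⟨ solve 3 (λ a b y → b := (y :* con 0) :* a :+ con 1 :* b) refl _ _ y ⟩
      y * 0# * g p + 1# * g (suc p)     ≈⟨ +-cong (*-congʳ (*-congˡ F[0])) (*-congʳ F[1]) ⟨
      y * F 0 * g p + F 1 * g (suc p)   ∎
    addition {g} g-rec (suc (suc j)) p = begin
      g (suc (suc j) ℕ.+ p)
        ≈⟨ g-rec (j ℕ.+ p) ⟩
      x * g (suc j ℕ.+ p) + y * g (j ℕ.+ p)
        ≈⟨ +-cong (*-congˡ (addition {g} g-rec (suc j) p)) (*-congˡ (addition {g} g-rec j p)) ⟩
      x * (E (suc j) * g p + F (suc j) * g (suc p)) + y * (E j * g p + F j * g (suc p))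
        ≈⟨ solve 8 (λ x y a b c d u v →
             x :* (a :* u :+ b :* v) :+ y :* (c :* u :+ d :* v)
             := (x :* a :+ y :* c) :* u :+ (x :* b :+ y :* d) :* v)
             refl x y (E (suc j)) (F (suc j)) (E j) (F j) (g p) (g (suc p)) ⟩
      (x * E (suc j) + y * E j) * g p + (x * F (suc j) + y * F j) * g (suc p)
        ≈⟨ +-cong (*-congʳ (E-rec j)) (*-congʳ (F-rec j)) ⟨
      E (suc (suc j)) * g p + F (suc (suc j)) * g (suc p) ∎

    -- As in the determinant form of Cassini's identity, moving one step multiplies
    -- F (i + 1) g (i + p) - F i g (i + 1 + p) by - y.
    cassini : ∀ {g} → Recurrent g → ∀ i p →
              F (suc i) * g (i ℕ.+ p) ≈ F i * g (suc i ℕ.+ p) + (- y) ^ i * g p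
    cassini {g} g-rec zero p = begin
      F 1 * g p                     ≈⟨ *-congʳ F[1] ⟩
      1# * g p                      ≈⟨ solve 2 (λ a b → con 1 :* a := con 0 :* b :+ con 1 :* a) refl _ _ ⟩
      0# * g (suc p) + 1# * g p     ≈⟨ +-congʳ (*-congʳ F[0]) ⟨
      F 0 * g (suc p) + 1# * g p    ∎
    cassini {g} g-rec (suc i) p = begin
      F (suc (suc i)) * g₁
        ≈⟨ *-congʳ (F-rec i) ⟩
      (x * F (suc i) + y * F i) * g₁
        -- The term `0# * r` becomes (y - y) r. Its part y r completes the induction hypothesis, and
        -- `- y` is an atom for the semiring solver.
        ≈⟨ solve 6 (λ x y a b g r →
             (x :* a :+ y :* b) :* g := (x :* a :* g :+ y :* (b :* g)) :+ con 0 :* r)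
             refl x y (F (suc i)) (F i) g₁ r ⟩
      (x * F (suc i) * g₁ + y * (F i * g₁)) + 0# * r
        ≈⟨ +-congˡ (*-congʳ (-‿inverseʳ y)) ⟨
      (x * F (suc i) * g₁ + y * (F i * g₁)) + (y + - y) * r
        ≈⟨ solve 7 (λ x y z a b g r →
             (x :* a :* g :+ y :* (b :* g)) :+ (y :+ z) :* r
             := (x :* a :* g :+ y :* (b :* g :+ r)) :+ z :* r)
             refl x y (- y) (F (suc i)) (F i) g₁ r ⟩
      (x * F (suc i) * g₁ + y * (F i * g₁ + r)) + - y * r
        ≈⟨ +-congʳ (+-congˡ (*-congˡ (cassini {g} g-rec i p))) ⟨
      (x * F (suc i) * g₁ + y * (F (suc i) * g₀)) + - y * r
        ≈⟨ solve 8 (λ x y z a g g₀ e p →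
             (x :* a :* g :+ y :* (a :* g₀)) :+ z :* (e :* p)
             := a :* (x :* g :+ y :* g₀) :+ z :* e :* p)
             refl x y (- y) (F (suc i)) g₁ g₀ ((- y) ^ i) (g p) ⟩
      F (suc i) * (x * g₁ + y * g₀) + - y * (- y) ^ i * g p
        ≈⟨ +-congʳ (*-congˡ (g-rec (i ℕ.+ p))) ⟨
      F (suc i) * g (suc (suc i) ℕ.+ p) + - y * (- y) ^ i * g p ∎
      where
      g₀ g₁ r : Carrier
      g₀ = g (i ℕ.+ p)
      g₁ = g (suc i ℕ.+ p)
      r  = (- y) ^ i * g p

    -- The addition formula splits F (j + i) into multiples of F i and F (i + 1). Cassini's identity
    -- rewrites the second product, and the addition formula for `g` collects the multiples of F i.
    vajda : ∀ {g} → Recurrent g → ∀ j i p →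
            F (j ℕ.+ i) * g (i ℕ.+ p) ≈ F i * g (j ℕ.+ (i ℕ.+ p)) + (- y) ^ i * F j * g p
    vajda {g} g-rec j i p = begin
      F (j ℕ.+ i) * g₀
        ≈⟨ *-congʳ (addition F-rec j i) ⟩
      (E j * F i + F j * F (suc i)) * g₀
        ≈⟨ solve 5 (λ e f a b g → (e :* a :+ f :* b) :* g := e :* a :* g :+ f :* (b :* g))
             refl (E j) (F j) (F i) (F (suc i)) g₀ ⟩
      E j * F i * g₀ + F j * (F (suc i) * g₀)
        ≈⟨ +-congˡ (*-congˡ (cassini {g} g-rec i p)) ⟩
      E j * F i * g₀ + F j * (F i * g₁ + (- y) ^ i * g p)
        ≈⟨ solve 7 (λ e f a g₀ g₁ z u →
             e :* a :* g₀ :+ f :* (a :* g₁ :+ z :* u)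
             := a :* (e :* g₀ :+ f :* g₁) :+ z :* f :* u)
             refl (E j) (F j) (F i) g₀ g₁ ((- y) ^ i) (g p) ⟩
      F i * (E j * g₀ + F j * g₁) + (- y) ^ i * F j * g p
        ≈⟨ +-congʳ (*-congˡ (addition {g} g-rec j (i ℕ.+ p))) ⟨
      F i * g (j ℕ.+ (i ℕ.+ p)) + (- y) ^ i * F j * g p ∎
      where
      g₀ g₁ : Carrier
      g₀ = g (i ℕ.+ p)
      g₁ = g (suc (i ℕ.+ p))

    -- The polynomials with coefficients `coef N`, and the step from N to N + 1

    Fs : ℕ → Carrier
    Fs n = F (s ℕ.* n)

    Fs[0] : Fs 0 ≈ 0#
    Fs[0] = trans (≡⇒≈ (≡.cong F (ℕₚ.*-zeroʳ s))) F[0]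

    -- Since the roots satisfy αβ = -y, this is αˢβˢ.
    q : Carrier
    q = (- y) ^ s

    vajdaₛ : ∀ {g} → Recurrent g → ∀ j i p →
             Fs (j ℕ.+ i) * g (s ℕ.* (i ℕ.+ p))
             ≈ Fs i * g (s ℕ.* (j ℕ.+ (i ℕ.+ p))) + q ^ i * Fs j * g (s ℕ.* p)
    vajdaₛ {g} g-rec j i p = begin
      Fs (j ℕ.+ i) * g (s ℕ.* (i ℕ.+ p))
        ≡⟨ ≡.cong₂ (λ a b → F a * g b) (ℕₚ.*-distribˡ-+ s j i) (ℕₚ.*-distribˡ-+ s i p) ⟩
      F (s ℕ.* j ℕ.+ s ℕ.* i) * g (s ℕ.* i ℕ.+ s ℕ.* p)
        ≈⟨ vajda {g} g-rec (s ℕ.* j) (s ℕ.* i) (s ℕ.* p) ⟩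
      Fs i * g (s ℕ.* j ℕ.+ (s ℕ.* i ℕ.+ s ℕ.* p)) + (- y) ^ (s ℕ.* i) * Fs j * g (s ℕ.* p)
        ≈⟨ +-cong (≡⇒≈ (≡.cong (λ a → Fs i * g a) (≡.sym index)))
             (*-congʳ (*-congʳ (sym (^-assocʳ (- y) s i)))) ⟩
      Fs i * g (s ℕ.* (j ℕ.+ (i ℕ.+ p))) + q ^ i * Fs j * g (s ℕ.* p) ∎
      where
      index : s ℕ.* (j ℕ.+ (i ℕ.+ p)) ≡ s ℕ.* j ℕ.+ (s ℕ.* i ℕ.+ s ℕ.* p)
      index = ≡.trans (ℕₚ.*-distribˡ-+ s j (i ℕ.+ p))
        (≡.cong (s ℕ.* j ℕ.+_) (ℕₚ.*-distribˡ-+ s i p))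

    -- d j = (-1)ʲ q^(j(j-1)/2), so that Σⱼ (coef N j) zʲ = Π_{i<N} (1 - αˢⁱ βˢ⁽ᴺ⁻¹⁻ⁱ⁾ z)
    -- for the roots α, β of T² = x T + y.
    d : ℕ → Carrier
    d zero    = 1#
    d (suc j) = - (q ^ j) * d j

    coef : ℕ → ℕ → Carrier
    coef N j = d j * B N j

    -- The coefficients of z times the polynomial given by `coef N`.
    coef↑ : ℕ → ℕ → Carrier
    coef↑ N zero    = 0#
    coef↑ N (suc j) = coef N j

    coef≈0 : ∀ {N j} → N < j → coef N j ≈ 0#
    coef≈0 N<j = trans (*-congˡ (B[n,k]≈0 N<j)) (zeroʳ _)

    -- For j > 0, `absorb` lowers both indices of `B`, and the powers of q combine because (j - 1) +
    -- i = N. At j = 0 both sides vanish, as Fs 0 = 0.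
    shift-coef : ∀ N j i → j ℕ.+ i ≡ suc N →
      q ^ i * d j * (Fs j * B (suc N) j) ≈ Fs (suc N) * (- (q ^ N) * coef↑ N j)
    shift-coef N zero i eq = begin
      q ^ i * 1# * (Fs 0 * B (suc N) 0)  ≈⟨ *-congˡ (*-congʳ Fs[0]) ⟩
      q ^ i * 1# * (0# * B (suc N) 0)    ≈⟨ solve 4 (λ a b c e → a :* con 1 :* (con 0 :* b) := c :* (e :* con 0)) refl _ _ _ _ ⟩
      Fs (suc N) * (- (q ^ N) * 0#)      ∎
    shift-coef N (suc j) i eq = begin
      q ^ i * (- (q ^ j) * d j) * (Fs (suc j) * B (suc N) (suc j))
        ≈⟨ *-congˡ (absorb N j) ⟨
      q ^ i * (- (q ^ j) * d j) * (Fs (suc N) * B N j)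
        ≈⟨ solve 5 (λ a m e f b → a :* (m :* e) :* (f :* b) := f :* (m :* a :* (e :* b))) refl
             (q ^ i) (- (q ^ j)) (d j) (Fs (suc N)) (B N j) ⟩
      Fs (suc N) * (- (q ^ j) * q ^ i * (d j * B N j))
        ≈⟨ *-congˡ (*-congʳ power) ⟩
      Fs (suc N) * (- (q ^ N) * (d j * B N j)) ∎
      where
      power : - (q ^ j) * q ^ i ≈ - (q ^ N)
      power = begin
        - (q ^ j) * q ^ i   ≈⟨ -‿distribˡ-* _ _ ⟨
        - (q ^ j * q ^ i)   ≈⟨ -‿cong (^-homo-* q j i) ⟨
        - (q ^ (j ℕ.+ i))   ≡⟨ ≡.cong (λ e → - (q ^ e)) (ℕₚ.suc-injective eq) ⟩
        - (q ^ N)           ∎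

    -- With i = N + 1 - j, the factor `Fs i` is taken up by `absorb′` and `Fs j` by `shift-coef`.
    -- For j > N + 1 no such i exists, but then every coefficient is 0.
    step-term : ∀ N j {w a b} u →
      (∀ i → j ℕ.+ i ≡ suc N → Fs (suc N) * w ≈ Fs i * a + q ^ i * Fs j * b) →
      Fs (suc N) * (coef (suc N) j * (w * u))
      ≈ Fs (suc N) * (a * (coef N j * u) + - (q ^ N) * b * (coef↑ N j * u))
    step-term N j {w} {a} {b} u hyp with ℕₚ.≤-<-connex j (suc N)
    ... | inj₂ N<j@(s≤s N≤j-1) = *-congˡ (begin
      coef (suc N) j * (w * u)
        ≈⟨ *-congʳ (coef≈0 N<j) ⟩
      0# * (w * u)
        ≈⟨ solve 5 (λ w u a m b → con 0 :* (w :* u) := a :* (con 0 :* u) :+ m :* b :* (con 0 :* u))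
             refl w u a _ b ⟩
      a * (0# * u) + - (q ^ N) * b * (0# * u)
        ≈⟨ +-cong (*-congˡ (*-congʳ (coef≈0 (ℕₚ.<-trans (ℕₚ.n<1+n N) N<j))))
             (*-congˡ (*-congʳ (coef≈0 N≤j-1))) ⟨
      a * (coef N j * u) + - (q ^ N) * b * (coef↑ N j * u) ∎)
    ... | inj₁ j≤1+N = begin
      f * (d j * B (suc N) j * (w * u))
        ≈⟨ solve 5 (λ f d B w u → f :* (d :* B :* (w :* u)) := d :* B :* u :* (f :* w))
             refl f (d j) (B (suc N) j) w u ⟩
      d j * B (suc N) j * u * (f * w)
        ≈⟨ *-congˡ (hyp i j+i≡1+N) ⟩
      d j * B (suc N) j * u * (Fs i * a + q ^ i * Fs j * b)
        ≈⟨ solve 8 (λ d B u h a p k b →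
             d :* B :* u :* (h :* a :+ p :* k :* b)
             := a :* d :* u :* (h :* B) :+ b :* u :* (p :* d :* (k :* B)))
             refl (d j) (B (suc N) j) u (Fs i) a (q ^ i) (Fs j) b ⟩
      a * d j * u * (Fs i * B (suc N) j) + b * u * (q ^ i * d j * (Fs j * B (suc N) j))
        ≈⟨ +-cong (*-congˡ (sym (absorb′ N j))) (*-congˡ (shift-coef N j i j+i≡1+N)) ⟩
      a * d j * u * (f * B N j) + b * u * (f * (- (q ^ N) * coef↑ N j))
        ≈⟨ solve 8 (λ a d u f B b m c →
             a :* d :* u :* (f :* B) :+ b :* u :* (f :* (m :* c))
             := f :* (a :* (d :* B :* u) :+ m :* b :* (c :* u)))
             refl a (d j) u f (B N j) b (- (q ^ N)) (coef↑ N j) ⟩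
      f * (a * (coef N j * u) + - (q ^ N) * b * (coef↑ N j * u)) ∎
      where
      i : ℕ
      i = suc N ∸ j
      j+i≡1+N : j ℕ.+ i ≡ suc N
      j+i≡1+N = ℕₚ.m+[n∸m]≡n j≤1+N
      f : Carrier
      f = Fs (suc N)

    -- The common engine of `annihilated-suc` and `coef⋆diagonal`. The weights `a` and `b` do not
    -- depend on j, so summing `step-term` leaves two convolutions with `coef N`.
    step : ∀ N n (w u : ℕ → Carrier) {a b} →
      (∀ j i k → j ℕ.+ i ≡ suc N → j ℕ.+ k ≡ suc n →
         Fs (suc N) * w k ≈ Fs i * a + q ^ i * Fs j * b) →
      (coef (suc N) ⋆ (λ k → w k * u k)) (suc n)
      ≈ a * (coef N ⋆ u) (suc n) + - (q ^ N) * b * (coef N ⋆ u) n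
    step N n w u {a} {b} hyp = cancel N (begin
      f * (coef (suc N) ⋆ (λ k → w k * u k)) (suc n)
        ≈⟨ ∑≤-*ˡ (suc n) f (λ j → coef (suc N) j * (w (suc n ∸ j) * u (suc n ∸ j))) ⟩
      ∑≤ (suc n) (λ j → f * (coef (suc N) j * (w (suc n ∸ j) * u (suc n ∸ j))))
        ≈⟨ ∑≤-cong (suc n) _ (λ j → f * (v₁ j + v₂ j)) (λ j j≤1+n → step-term N j (u (suc n ∸ j))
             λ i eq → hyp j i (suc n ∸ j) eq (ℕₚ.m+[n∸m]≡n j≤1+n)) ⟩
      ∑≤ (suc n) (λ j → f * (v₁ j + v₂ j))
        ≈⟨ ∑≤-*ˡ (suc n) f (λ j → v₁ j + v₂ j) ⟨
      f * ∑≤ (suc n) (λ j → v₁ j + v₂ j)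
        ≈⟨ *-congˡ (∑≤-+ (suc n) v₁ v₂) ⟩
      f * (∑≤ (suc n) v₁ + ∑≤ (suc n) v₂)
        ≈⟨ *-congˡ (+-cong (∑≤-*ˡ (suc n) a (λ j → coef N j * u (suc n ∸ j)))
             (∑≤-*ˡ (suc n) m (λ j → coef↑ N j * u (suc n ∸ j)))) ⟨
      -- `coef↑ N` is 0 at j = 0, and its remaining terms are by unfolding the convolution at n.
      f * (a * (coef N ⋆ u) (suc n) + m * (0# * u (suc n) + (coef N ⋆ u) n))
        ≈⟨ *-congˡ (+-congˡ (*-congˡ (trans (+-congʳ (zeroˡ _)) (+-identityˡ _)))) ⟩
      f * (a * (coef N ⋆ u) (suc n) + m * (coef N ⋆ u) n) ∎)
      where
      f m : Carrier
      f = Fs (suc N)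
      m = - (q ^ N) * b
      v₁ v₂ : ℕ → Carrier
      v₁ j = a * (coef N j * u (suc n ∸ j))
      v₂ j = m * (coef↑ N j * u (suc n ∸ j))

    -- Linear recurrences with coefficients `coef N`

    B[n,n] : ∀ n → B n n ≈ 1#
    B[n,n] zero    = B[n,0] 0
    B[n,n] (suc n) = trans (cancel n (sym (absorb n n))) (B[n,n] n)

    coef[0] : ∀ N → coef N 0 ≈ 1#
    coef[0] N = trans (*-identityˡ _) (B[n,0] N)

    -- `coef 1` is the polynomial 1 - z, so it acts as the backward difference.
    coef₁⋆ : ∀ u n → (coef 1 ⋆ u) (suc n) ≈ u (suc n) + - u n
    coef₁⋆ u n = begin
      coef 1 0 * u (suc n) + ∑≤ n (λ j → coef 1 (suc j) * u (n ∸ j))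
        ≈⟨ +-cong (trans (*-congʳ (coef[0] 1)) (*-identityˡ _))
             (∑≤-extend 0 n (λ j → coef 1 (suc j) * u (n ∸ j)) λ { (suc j) _ _ → trans (*-congʳ (coef≈0 (s≤s (s≤s z≤n)))) (zeroˡ _) }) ⟩
      u (suc n) + (coef 1 1 * u n + 0#)
        ≈⟨ +-congˡ (trans (+-identityʳ _) (*-congʳ coef₁[1])) ⟩
      u (suc n) + - 1# * u n
        ≈⟨ +-congˡ (-1*x≈-x (u n)) ⟩
      u (suc n) + - u n ∎
      where
      coef₁[1] : coef 1 1 ≈ - 1#
      coef₁[1] = trans (*-congˡ (B[n,n] 1)) (trans (*-identityʳ _) (*-identityʳ _))

    -- Multiplying the generating function of `u` by the polynomial of `coef N` leaves a polynomial
    -- of degree below N. From n = N on, the recurrence does not reach before index 0.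
    Annihilated : ℕ → (ℕ → Carrier) → Set ℓ
    Annihilated N u = ∀ n → N ≤ n → (coef N ⋆ u) n ≈ 0#

    annihilated-cong : ∀ {N u v} → (∀ n → u n ≈ v n) → Annihilated N u → Annihilated N v
    annihilated-cong {N} u≈v ann n N≤n = trans (⋆-congˡ (coef N) (sym ∘ u≈v) n) (ann n N≤n)

    annihilated-+ : ∀ {N u v} → Annihilated N u → Annihilated N v →
                    Annihilated N (λ n → u n + v n)
    annihilated-+ {N} {u} {v} ann-u ann-v n N≤n = begin
      (coef N ⋆ (λ n → u n + v n)) n      ≈⟨ ⋆-+ (coef N) u v n ⟩
      (coef N ⋆ u) n + (coef N ⋆ v) n     ≈⟨ +-cong (ann-u n N≤n) (ann-v n N≤n) ⟩
      0# + 0#                             ≈⟨ +-identityˡ 0# ⟩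
      0#                                  ∎

    annihilated-* : ∀ {N u} a → Annihilated N u → Annihilated N (λ n → a * u n)
    annihilated-* {N} {u} a ann n N≤n =
      trans (⋆-* a (coef N) u n) (trans (*-congˡ (ann n N≤n)) (zeroʳ a))

    annihilated-1 : Annihilated 1 (λ _ → 1#)
    annihilated-1 (suc n) _ = trans (coef₁⋆ (λ _ → 1#) n) (-‿inverseʳ 1#)

    -- Vajda's identity supplies the weights for `step`, and both resulting convolutions vanish
    -- because N ≤ n.
    annihilated-suc : ∀ {N u g} → Recurrent g → Annihilated N u →
                      Annihilated (suc N) (λ n → g (s ℕ.* n) * u n)
    annihilated-suc {N} {u} {g} g-rec ann (suc n) 1+N≤1+n@(s≤s N≤n) = begin
      (coef (suc N) ⋆ (λ k → g (s ℕ.* k) * u k)) (suc n)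
        ≈⟨ step N n (λ k → g (s ℕ.* k)) u hyp ⟩
      g (s ℕ.* suc n) * (coef N ⋆ u) (suc n) + - (q ^ N) * g (s ℕ.* p) * (coef N ⋆ u) n
        ≈⟨ +-cong (*-congˡ (ann (suc n) (ℕₚ.m≤n⇒m≤1+n N≤n))) (*-congˡ (ann n N≤n)) ⟩
      g (s ℕ.* suc n) * 0# + - (q ^ N) * g (s ℕ.* p) * 0#
        ≈⟨ solve 2 (λ a b → a :* con 0 :+ b :* con 0 := con 0) refl _ _ ⟩
      0# ∎
      where
      -- Since j + i = N + 1 and j + k = n + 1, this choice gives i + p = k for every j, so the
      -- weight g (s p) is the same in all terms.
      p : ℕ
      p = n ∸ N
      hyp : ∀ j i k → j ℕ.+ i ≡ suc N → j ℕ.+ k ≡ suc n →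
            Fs (suc N) * g (s ℕ.* k) ≈ Fs i * g (s ℕ.* suc n) + q ^ i * Fs j * g (s ℕ.* p)
      hyp j i k j+i≡1+N j+k≡1+n = ≡.subst₂
        (λ M r → Fs M * g (s ℕ.* k) ≈ Fs i * g (s ℕ.* r) + q ^ i * Fs j * g (s ℕ.* p))
        j+i≡1+N j+k≡1+n
        (≡.subst (λ k → Fs (j ℕ.+ i) * g (s ℕ.* k)
                        ≈ Fs i * g (s ℕ.* (j ℕ.+ k)) + q ^ i * Fs j * g (s ℕ.* p))
          i+p≡k (vajdaₛ {g} g-rec j i p))
        where
        i+p≡k : i ℕ.+ p ≡ k
        i+p≡k = ℕₚ.+-cancelˡ-≡ j (i ℕ.+ p) k (≡.trans (≡.sym (ℕₚ.+-assoc j i p))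
          (≡.trans (≡.cong (ℕ._+ p) j+i≡1+N)
            (≡.trans (ℕₚ.m+[n∸m]≡n 1+N≤1+n) (≡.sym j+k≡1+n))))

    -- Induction on t: the addition formula for g (s n + s t n) gives two products of a factor `E`
    -- or `F` at s n with a t-fold dilation of `g` or of its shift, which is again recurrent. At t =
    -- 0 the factor is the constant g 0.
    annihilated-dilate : ∀ t {N u g} → Recurrent g → Annihilated N u →
                         Annihilated (t ℕ.+ N) (λ n → g (s ℕ.* t ℕ.* n) * u n)
    annihilated-dilate zero {N} {u} {g} g-rec ann = annihilated-cong
      (λ n → *-congʳ (≡⇒≈ (≡.cong (λ a → g (a ℕ.* n)) (≡.sym (ℕₚ.*-zeroʳ s)))))
      (annihilated-* (g 0) ann)
    annihilated-dilate (suc t) {N} {u} {g} g-rec ann = annihilated-cong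
      (λ n → begin
        E (s ℕ.* n) * (g (s ℕ.* t ℕ.* n) * u n) + Fs n * (g (suc (s ℕ.* t ℕ.* n)) * u n)
          ≈⟨ solve 5 (λ e a u f b → e :* (a :* u) :+ f :* (b :* u) := (e :* a :+ f :* b) :* u)
               refl (E (s ℕ.* n)) (g (s ℕ.* t ℕ.* n)) (u n) (Fs n) (g (suc (s ℕ.* t ℕ.* n))) ⟩
        (E (s ℕ.* n) * g (s ℕ.* t ℕ.* n) + Fs n * g (suc (s ℕ.* t ℕ.* n))) * u n
          ≈⟨ *-congʳ (addition {g} g-rec (s ℕ.* n) (s ℕ.* t ℕ.* n)) ⟨
        g (s ℕ.* n ℕ.+ s ℕ.* t ℕ.* n) * u n
          ≡⟨ ≡.cong (λ a → g a * u n) (≡.sym (index n)) ⟩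
        g (s ℕ.* suc t ℕ.* n) * u n ∎)
      (annihilated-+
        (annihilated-suc E-rec (annihilated-dilate t g-rec ann))
        (annihilated-suc F-rec (annihilated-dilate t (g-rec ∘ suc) ann)))
      where
      index : ∀ n → s ℕ.* suc t ℕ.* n ≡ s ℕ.* n ℕ.+ s ℕ.* t ℕ.* n
      index n = ≡.trans (≡.cong (ℕ._* n) (ℕₚ.*-suc s t)) (ℕₚ.*-distribʳ-+ n s (s ℕ.* t))

    annihilated-^ : ∀ t k {N u g} → Recurrent g → Annihilated N u →
                    Annihilated (t ℕ.* k ℕ.+ N) (λ n → g (s ℕ.* t ℕ.* n) ^ k * u n)
    annihilated-^ t zero {N} {u} {g} g-rec ann = ≡.subst
      (λ M → Annihilated M (λ n → 1# * u n))
      (≡.cong (ℕ._+ N) (≡.sym (ℕₚ.*-zeroʳ t)))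
      (annihilated-* 1# ann)
    annihilated-^ t (suc k) {N} {u} {g} g-rec ann = ≡.subst
      (λ M → Annihilated M (λ n → g (s ℕ.* t ℕ.* n) ^ suc k * u n))
      (≡.trans (≡.sym (ℕₚ.+-assoc t (t ℕ.* k) N)) (≡.cong (ℕ._+ N) (≡.sym (ℕₚ.*-suc t k))))
      (annihilated-cong (λ n → sym (*-assoc _ _ _))
        (annihilated-dilate t g-rec (annihilated-^ t k g-rec ann)))

    -- The empty product is the constant sequence 1, annihilated by 1 - z; this accounts for the
    -- order K + 1 instead of K.
    annihilated-product : ∀ l (k t : Vector ℕ l) (g : Vector (ℕ → Carrier) l) →
      (∀ r → Recurrent (g r)) →
      Annihilated (suc (foldr ℕ._+_ 0 λ r → t r ℕ.* k r))
                  (λ n → product λ r → g r (s ℕ.* t r ℕ.* n) ^ k r)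
    annihilated-product zero    k t g g-rec = annihilated-1
    annihilated-product (suc l) k t g g-rec = ≡.subst
      (λ M → Annihilated M (λ n → product λ r → g r (s ℕ.* t r ℕ.* n) ^ k r))
      (ℕₚ.+-suc (t Fin.zero ℕ.* k Fin.zero) _)
      (annihilated-^ (t Fin.zero) (k Fin.zero) (g-rec Fin.zero)
        (annihilated-product l (k ∘ Fin.suc) (t ∘ Fin.suc) (g ∘ Fin.suc) (g-rec ∘ Fin.suc)))

    -- The reciprocal power series and the expansion

    diagonal : ℕ → ℕ → Carrier
    diagonal K n = B (n ℕ.+ K) K

    -- Induction on K: `absorb` turns `diagonal (suc K)` into `diagonal K` times a value of `Fs`, up
    -- to a factor that cancels, so `step` applies. For K = 0 it says that (1 - z)(1 + z + z² + ...)
    -- = 1.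
    coef⋆diagonal : ∀ K n → (coef (suc K) ⋆ diagonal K) n ≈ δ n
    coef⋆diagonal K zero = begin
      coef (suc K) 0 * B K K + 0#  ≈⟨ +-identityʳ _ ⟩
      coef (suc K) 0 * B K K       ≈⟨ *-cong (coef[0] (suc K)) (B[n,n] K) ⟩
      1# * 1#                      ≈⟨ *-identityˡ 1# ⟩
      1#                           ∎
    coef⋆diagonal zero (suc n) = begin
      (coef 1 ⋆ diagonal 0) (suc n)             ≈⟨ coef₁⋆ (diagonal 0) n ⟩
      B (suc n ℕ.+ 0) 0 + - B (n ℕ.+ 0) 0       ≈⟨ +-cong (B[n,0] _) (-‿cong (B[n,0] _)) ⟩
      1# + - 1#                                 ≈⟨ -‿inverseʳ 1# ⟩
      0#                                        ∎
    coef⋆diagonal (suc K) (suc n) = cancel K (begin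
      Fs (suc K) * (coef (suc (suc K)) ⋆ diagonal (suc K)) (suc n)
        ≈⟨ ⋆-* (Fs (suc K)) (coef (suc (suc K))) (diagonal (suc K)) (suc n) ⟨
      (coef (suc (suc K)) ⋆ (λ k → Fs (suc K) * diagonal (suc K) k)) (suc n)
        ≈⟨ ⋆-congˡ (coef (suc (suc K))) diagonal-suc (suc n) ⟩
      (coef (suc (suc K)) ⋆ (λ k → Fs (k ℕ.+ suc K) * diagonal K k)) (suc n)
        ≈⟨ step (suc K) n (λ k → Fs (k ℕ.+ suc K)) (diagonal K) hyp ⟩
      Fs (suc n ℕ.+ suc K) * (coef (suc K) ⋆ diagonal K) (suc n)
      + - (q ^ suc K) * Fs n * (coef (suc K) ⋆ diagonal K) n
        ≈⟨ +-cong (*-congˡ (coef⋆diagonal K (suc n))) (*-congˡ (coef⋆diagonal K n)) ⟩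
      Fs (suc n ℕ.+ suc K) * 0# + - (q ^ suc K) * Fs n * δ n
        -- In the last term `Fs n` is 0 at n = 0, and `δ n` is 0 at n > 0.
        ≈⟨ +-cong (zeroʳ _) (trans (*-assoc _ _ _) (trans (*-congˡ (Fs*δ n)) (zeroʳ _))) ⟩
      0# + 0#
        ≈⟨ trans (+-identityˡ 0#) (sym (zeroʳ _)) ⟩
      Fs (suc K) * 0# ∎)
      where
      Fs*δ : ∀ n → Fs n * δ n ≈ 0#
      Fs*δ zero    = trans (*-identityʳ _) Fs[0]
      Fs*δ (suc n) = zeroʳ _

      diagonal-suc : ∀ k → Fs (suc K) * diagonal (suc K) k ≈ Fs (k ℕ.+ suc K) * diagonal K k
      diagonal-suc k = ≡.subst (λ r → Fs (suc K) * B r (suc K) ≈ Fs r * B (k ℕ.+ K) K)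
        (≡.sym (ℕₚ.+-suc k K)) (sym (absorb (k ℕ.+ K) K))

      hyp : ∀ j i k → j ℕ.+ i ≡ suc (suc K) → j ℕ.+ k ≡ suc n →
            Fs (suc (suc K)) * Fs (k ℕ.+ suc K)
            ≈ Fs i * Fs (suc n ℕ.+ suc K) + q ^ i * Fs j * Fs n
      hyp j i k j+i≡2+K j+k≡1+n = ≡.subst₂
        (λ M r → Fs M * Fs (k ℕ.+ suc K) ≈ Fs i * Fs r + q ^ i * Fs j * Fs n)
        j+i≡2+K (≡.trans (≡.sym (ℕₚ.+-assoc j k (suc K))) (≡.cong (ℕ._+ suc K) j+k≡1+n))
        (≡.subst (λ r → Fs (j ℕ.+ i) * Fs r ≈ Fs i * Fs (j ℕ.+ r) + q ^ i * Fs j * Fs n)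
          i+n≡k+1+K (vajdaₛ F-rec j i n))
        where
        i+n≡k+1+K : i ℕ.+ n ≡ k ℕ.+ suc K
        i+n≡k+1+K = ℕₚ.+-cancelˡ-≡ j (i ℕ.+ n) (k ℕ.+ suc K) (≡.trans (≡.sym (ℕₚ.+-assoc j i n))
          (≡.trans (≡.cong (ℕ._+ n) j+i≡2+K)
            (≡.trans (≡.cong suc (ℕₚ.+-comm (suc K) n))
              (≡.trans (≡.cong (ℕ._+ suc K) (≡.sym j+k≡1+n)) (ℕₚ.+-assoc j k (suc K))))))

    -- Multiply `a` by its annihilating polynomial, then by the reciprocal series.
    expansion : ∀ K a → Annihilated (suc K) a → ∀ n →
                a n ≈ ∑≤ K (λ i → (coef (suc K) ⋆ a) i * B (n ℕ.+ K ∸ i) K)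
    expansion K a ann n = begin
      a n
        ≈⟨ ⋆-identityˡ a n ⟨
      (δ ⋆ a) n
        ≈⟨ ⋆-congʳ a (λ k → trans (⋆-comm (diagonal K) (coef (suc K)) k) (coef⋆diagonal K k)) n ⟨
      ((diagonal K ⋆ coef (suc K)) ⋆ a) n
        ≈⟨ ⋆-assoc (diagonal K) (coef (suc K)) a n ⟩
      (diagonal K ⋆ e) n
        ≈⟨ ⋆-comm (diagonal K) e n ⟩
      (e ⋆ diagonal K) n
        ≈⟨ ∑≤-cong n f (λ i → e i * diagonal K (n ∸ i)) (λ i i≤n → *-congˡ (≡⇒≈ (≡.cong (λ r → B r K) (ℕₚ.+-∸-comm K i≤n)))) ⟨
      ∑≤ n f
        -- Cutting at n and cutting at K both agree with the sum up to n + K: above n the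
        -- coefficient `B` vanishes, above K the factor `e` does.
        ≈⟨ ∑≤-extend n K f beyond-n ⟨
      ∑≤ (n ℕ.+ K) f
        ≡⟨ ≡.cong (λ r → ∑≤ r f) (ℕₚ.+-comm n K) ⟩
      ∑≤ (K ℕ.+ n) f
        ≈⟨ ∑≤-extend K n f (λ i K<i _ → trans (*-congʳ (ann i K<i)) (zeroˡ _)) ⟩
      ∑≤ K f ∎
      where
      e f : ℕ → Carrier
      e = coef (suc K) ⋆ a
      f i = e i * B (n ℕ.+ K ∸ i) K

      -- The bound i ≤ n + K matters: for K = 0 and i > n, truncated subtraction would give B 0 0 =
      -- 1.
      beyond-n : ∀ i → n < i → i ≤ n ℕ.+ K → f i ≈ 0#
      beyond-n i n<i i≤n+K = trans (*-congˡ (B[n,k]≈0 (ℕₚ.+-cancelʳ-< i _ K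
        (≡.subst (ℕ._< K ℕ.+ i) (≡.sym (ℕₚ.m∸n+n≡m i≤n+K))
          (≡.subst (n ℕ.+ K ℕ.<_) (ℕₚ.+-comm i K) (ℕₚ.+-monoˡ-< K n<i)))))) (zeroʳ _)

    -- Signs and powers of y in closed form

    [-1]^n*[-1]^n : ∀ n → (- 1#) ^ n * (- 1#) ^ n ≈ 1#
    [-1]^n*[-1]^n zero    = *-identityˡ 1#
    [-1]^n*[-1]^n (suc n) = begin
      - 1# * e * (- 1# * e)        ≈⟨ solve 2 (λ a e → a :* e :* (a :* e) := a :* a :* (e :* e)) refl _ _ ⟩
      - 1# * - 1# * (e * e)        ≈⟨ *-cong (trans (-1*x≈-x (- 1#)) (-‿involutive 1#)) ([-1]^n*[-1]^n n) ⟩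
      1# * 1#                      ≈⟨ *-identityˡ 1# ⟩
      1#                           ∎
      where
      e : Carrier
      e = (- 1#) ^ n

    q^j : ∀ j → q ^ j ≈ (- 1#) ^ (s ℕ.* j) * y ^ (s ℕ.* j)
    q^j j = begin
      q ^ j                                      ≈⟨ ^-assocʳ (- y) s j ⟩
      (- y) ^ (s ℕ.* j)                          ≈⟨ ^-congˡ (s ℕ.* j) (-1*x≈-x y) ⟨
      (- 1# * y) ^ (s ℕ.* j)                     ≈⟨ ^-distrib-* (- 1#) y (s ℕ.* j) ⟩
      (- 1#) ^ (s ℕ.* j) * y ^ (s ℕ.* j)         ∎

    -- The outer sign (-1)^(s+1) cancels the value s + 1 of the sign exponent at j = 0. From j to j
    -- + 1 both sides gain the factor `- (q ^ j)`, as (-1)^(2s) = 1.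
    d-closed : ∀ j → (- 1#) ^ (s ℕ.+ 1) * ((- 1#) ^ sign-exponent j * y ^ y-exponent j) ≈ d j
    d-closed zero = begin
      (- 1#) ^ (s ℕ.+ 1) * ((- 1#) ^ sign-exponent 0 * y ^ y-exponent 0)
        ≡⟨ ≡.cong₂ (λ m n → (- 1#) ^ (s ℕ.+ 1) * ((- 1#) ^ m * y ^ n))
             sign-exponent-zero y-exponent-zero ⟩
      (- 1#) ^ (s ℕ.+ 1) * ((- 1#) ^ (s ℕ.+ 1) * 1#)
        ≈⟨ *-congˡ (*-identityʳ _) ⟩
      (- 1#) ^ (s ℕ.+ 1) * (- 1#) ^ (s ℕ.+ 1)
        ≈⟨ [-1]^n*[-1]^n (s ℕ.+ 1) ⟩
      1# ∎
    d-closed (suc j) = begin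
      ε * ((- 1#) ^ sign-exponent (suc j) * y ^ y-exponent (suc j))
        ≡⟨ ≡.cong₂ (λ m n → ε * ((- 1#) ^ m * y ^ n)) (sign-exponent-suc j) (y-exponent-suc j) ⟩
      ε * ((- 1#) ^ (sign-exponent j ℕ.+ (s ℕ.* j ℕ.+ (s ℕ.+ s ℕ.+ 1))) * y ^ (y-exponent j ℕ.+ s ℕ.* j))
        ≈⟨ *-congˡ (*-cong split (^-homo-* y (y-exponent j) (s ℕ.* j))) ⟩
      ε * (A * (M * (S * S * (- 1# * 1#))) * (Y * Z))
        ≈⟨ *-congˡ (*-congʳ (*-congˡ (*-congˡ (*-congʳ ([-1]^n*[-1]^n s))))) ⟩
      ε * (A * (M * (1# * (- 1# * 1#))) * (Y * Z))
        ≈⟨ solve 6 (λ e a m n y z → e :* (a :* (m :* (con 1 :* (n :* con 1))) :* (y :* z))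
             := n :* (m :* z) :* (e :* (a :* y))) refl ε A M (- 1#) Y Z ⟩
      - 1# * (M * Z) * (ε * (A * Y))
        ≈⟨ *-cong (trans (-1*x≈-x _) (-‿cong (sym (q^j j)))) (d-closed j) ⟩
      - (q ^ j) * d j ∎
      where
      ε A M S Y Z : Carrier
      ε = (- 1#) ^ (s ℕ.+ 1)
      A = (- 1#) ^ sign-exponent j
      M = (- 1#) ^ (s ℕ.* j)
      S = (- 1#) ^ s
      Y = y ^ y-exponent j
      Z = y ^ (s ℕ.* j)
      split : (- 1#) ^ (sign-exponent j ℕ.+ (s ℕ.* j ℕ.+ (s ℕ.+ s ℕ.+ 1))) ≈ A * (M * (S * S * (- 1# * 1#)))
      split = trans (^-homo-* (- 1#) (sign-exponent j) _) (*-congˡ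
        (trans (^-homo-* (- 1#) (s ℕ.* j) _) (*-congˡ
          (trans (^-homo-* (- 1#) (s ℕ.+ s) 1) (*-congʳ (^-homo-* (- 1#) s s))))))

    signed-expansion : ∀ K a → Annihilated (suc K) a → ∀ n →
      a n ≈ (- 1#) ^ (s ℕ.+ 1) * ∑≤ K (λ i → ∑≤ i (λ j →
        (- 1#) ^ sign-exponent j * B (K ℕ.+ 1) j * a (i ∸ j) * y ^ y-exponent j * B (n ℕ.+ K ∸ i) K))
    signed-expansion K a ann n = begin
      a n
        ≈⟨ expansion K a ann n ⟩
      ∑≤ K (λ i → (coef (suc K) ⋆ a) i * H i)
        ≈⟨ ∑≤-cong K _ (λ i → ε * ∑≤ i (v i)) (λ i _ → begin
             (coef (suc K) ⋆ a) i * H i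
               ≈⟨ ∑≤-*ʳ i (H i) (λ j → coef (suc K) j * a (i ∸ j)) ⟩
             ∑≤ i (λ j → coef (suc K) j * a (i ∸ j) * H i)
               ≈⟨ ∑≤-cong i _ (λ j → ε * v i j) (λ j _ → summand i j) ⟩
             ∑≤ i (λ j → ε * v i j)
               ≈⟨ ∑≤-*ˡ i ε (v i) ⟨
             ε * ∑≤ i (v i) ∎) ⟩
      ∑≤ K (λ i → ε * ∑≤ i (v i))
        ≈⟨ ∑≤-*ˡ K ε (λ i → ∑≤ i (v i)) ⟨
      ε * ∑≤ K (λ i → ∑≤ i (v i)) ∎
      where
      ε : Carrier
      ε = (- 1#) ^ (s ℕ.+ 1)
      H : ℕ → Carrier
      H i = B (n ℕ.+ K ∸ i) K
      v : ℕ → ℕ → Carrier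
      v i j = (- 1#) ^ sign-exponent j * B (K ℕ.+ 1) j * a (i ∸ j) * y ^ y-exponent j * H i
      summand : ∀ i j → coef (suc K) j * a (i ∸ j) * H i ≈ ε * v i j
      summand i j = begin
        d j * B (suc K) j * a (i ∸ j) * H i
          ≈⟨ *-congʳ (*-congʳ (*-cong (sym (d-closed j)) (≡⇒≈ (≡.cong (λ N → B N j) (ℕₚ.+-comm 1 K))))) ⟩
        ε * ((- 1#) ^ sign-exponent j * y ^ y-exponent j) * B (K ℕ.+ 1) j * a (i ∸ j) * H i
          ≈⟨ solve 6 (λ e σ y b a h → e :* (σ :* y) :* b :* a :* h := e :* (σ :* b :* a :* y :* h)) refl
               ε ((- 1#) ^ sign-exponent j) (y ^ y-exponent j) (B (K ℕ.+ 1) j) (a (i ∸ j)) (H i) ⟩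
        ε * v i j ∎

-- Computing in the fraction field

module FractionFieldProperties (D : Ring) (D-isDomain : IsDomain D) where
  open FractionField D D-isDomain
  open CommutativeRing D
  open SemiringSolver commutativeSemiring using (solve; _:=_; _:+_; _:*_; con)
  private module 𝔽 = CommutativeRing frac-ring

  embed-+ : ∀ a b → embed (a + b) ≈ᶠ embed a +ᶠ embed b
  embed-+ a b = mk≈ (solve 2 (λ a b → (a :+ b) :* (con 1 :* con 1)
    := (a :* con 1 :+ b :* con 1) :* con 1) refl a b)

  embed-* : ∀ a b → embed (a * b) ≈ᶠ embed a *ᶠ embed b
  embed-* a b = mk≈ (solve 2 (λ a b → (a :* b) :* (con 1 :* con 1) := (a :* b) :* con 1) refl a b)

  embed-cancelˡ : ∀ {a f g} → ¬ a ≈ 0# → embed a *ᶠ f ≈ᶠ embed a *ᶠ g → f ≈ᶠ g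
  embed-cancelˡ {a} {f} {g} a≉0 af≈ag = begin
    f                      ≈⟨ a⁻¹*a* f ⟨
    a⁻¹ *ᶠ (embed a *ᶠ f)  ≈⟨ 𝔽.*-congˡ af≈ag ⟩
    a⁻¹ *ᶠ (embed a *ᶠ g)  ≈⟨ a⁻¹*a* g ⟩
    g                      ∎
    where
    open SetoidReasoning 𝔽.setoid
    a⁻¹ : Frac
    a⁻¹ = fraction 1# a a≉0
    a⁻¹*a* : ∀ h → a⁻¹ *ᶠ (embed a *ᶠ h) ≈ᶠ h
    a⁻¹*a* h = mk≈ (solve 3 (λ a n d → (con 1 :* (a :* n)) :* d := n :* (a :* (con 1 :* d)))
      refl a (num h) (den h))

  fraction≈0 : ∀ {p q q≉0} → p ≈ 0# → fraction p q q≉0 ≈ᶠ embed 0#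
  fraction≈0 p≈0 = mk≈ (trans (*-congʳ p≈0) (trans (zeroˡ _) (sym (zeroˡ _))))

  fraction≈1 : ∀ {p q q≉0} → p ≈ q → fraction p q q≉0 ≈ᶠ embed 1#
  fraction≈1 p≈q = mk≈ (trans (*-identityʳ _) (trans p≈q (sym (*-identityˡ _))))

  -- Reduces the absorption rules to identities between polynomials.
  embed-*-fraction : ∀ {a b p q p′ q′ q≉0 q′≉0} → a * p * q′ ≈ b * p′ * q →
    embed a *ᶠ fraction p q q≉0 ≈ᶠ embed b *ᶠ fraction p′ q′ q′≉0
  embed-*-fraction eq = mk≈ (trans (*-congˡ (*-identityˡ _)) (trans eq (*-congˡ (sym (*-identityˡ _)))))

-- `product` unfolds at its first factor, while the absorption rules also need the last one.
product-snoc : ∀ {c ℓ} (S : Semiring c ℓ) → let open Semiring S in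
  ∀ k (f : ℕ → Carrier) → let open RawSemiringDefs (Semiring.rawSemiring S) in
  product {suc k} (λ i → f (toℕ i)) ≈ product {k} (λ i → f (toℕ i)) * f k
product-snoc S zero    f = trans (*-identityʳ _) (sym (*-identityˡ _))
  where open Semiring S
product-snoc S (suc k) f = trans (*-congˡ (product-snoc S k (f ∘ suc))) (sym (*-assoc _ _ _))
  where open Semiring S

-- Absorption rules for the s-Fibopolynomials

module Fibopolynomial (s : ℕ) .{{_ : ℕ.NonZero s}} where
  open CommutativeRing ℂ[x,y].poly-ring
  open RawSemiringDefs (Semiring.rawSemiring semiring) using (product)
  open SetoidReasoning setoid
  open SemiringSolver commutativeSemiring using (solve; _:=_; _:*_)
  open FractionFieldProperties ℂ[x,y].poly-ring ℂ[x,y]-isDomain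
  private
    module 𝔽 = CommutativeRing RationalFunctions.frac-ring
    embed : Carrier → 𝔽.Carrier
    embed = RationalFunctions.embed

  F-rec : ∀ p → embed (F (suc (suc p))) 𝔽.≈ embed Defs.x 𝔽.* embed (F (suc p)) 𝔽.+ embed Defs.y 𝔽.* embed (F p)
  F-rec p = 𝔽.trans (embed-+ (Defs.x * F (suc p)) (Defs.y * F p))
    (𝔽.+-cong (embed-* Defs.x (F (suc p))) (embed-* Defs.y (F p)))

  cancel : ∀ n {a b} → embed (F (s ℕ.* suc n)) 𝔽.* a 𝔽.≈ embed (F (s ℕ.* suc n)) 𝔽.* b → a 𝔽.≈ b
  cancel n = embed-cancelˡ (F≉0 (s ℕ.* suc n) {{ℕₚ.m*n≢0 s (suc n)}})

  falling : ℕ → ℕ → Carrier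
  falling n k = product {k} λ i → F (s ℕ.* (n ∸ toℕ i))

  rising : ℕ → Carrier
  rising k = product {k} λ i → F (s ℕ.* suc (toℕ i))

  falling-snoc : ∀ n k → falling n (suc k) ≈ falling n k * F (s ℕ.* (n ∸ k))
  falling-snoc n k = product-snoc semiring k λ i → F (s ℕ.* (n ∸ i))

  rising-snoc : ∀ k → rising (suc k) ≈ rising k * F (s ℕ.* suc k)
  rising-snoc k = product-snoc semiring k λ i → F (s ℕ.* suc i)

  -- Removing first factors lowers n and k together until n = 0, where the leading factor is F (s *
  -- 0) = 0.
  falling≈0 : ∀ {n k} → n < k → falling n k ≈ 0#
  falling≈0 {zero}  {suc k} _         = trans
    (*-congʳ {product {k} λ _ → F (s ℕ.* 0)} (reflexive (≡.cong F (ℕₚ.*-zeroʳ s)))) (zeroˡ (product {k} λ _ → F (s ℕ.* 0)))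
  falling≈0 {suc n} {suc k} (s≤s n<k) = trans
    (*-congˡ {F (s ℕ.* suc n)} (falling≈0 {n} n<k)) (zeroʳ (F (s ℕ.* suc n)))

  fibopolynomial[n,0] : ∀ n → fibopolynomial s n 0 𝔽.≈ 𝔽.1#
  fibopolynomial[n,0] n = fraction≈1 refl

  fibopolynomial≈0 : ∀ {n k} → n < k → fibopolynomial s n k 𝔽.≈ 𝔽.0#
  fibopolynomial≈0 n<k = fraction≈0 (falling≈0 n<k)

  absorb : ∀ n k → embed (F (s ℕ.* suc n)) 𝔽.* fibopolynomial s n k
                 𝔽.≈ embed (F (s ℕ.* suc k)) 𝔽.* fibopolynomial s (suc n) (suc k)
  absorb n k = embed-*-fraction (begin
    Fₙ * falling n k * rising (suc k)       ≈⟨ *-congˡ {Fₙ * falling n k} (rising-snoc k) ⟩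
    Fₙ * falling n k * (rising k * Fₖ)      ≈⟨ solve 4 (λ a b c d → a :* b :* (c :* d) := d :* (a :* b) :* c) refl Fₙ (falling n k) (rising k) Fₖ ⟩
    -- `falling (suc n) (suc k)` unfolds to `Fₙ * falling n k`.
    Fₖ * falling (suc n) (suc k) * rising k ∎)
    where
    Fₙ Fₖ : Carrier
    Fₙ = F (s ℕ.* suc n)
    Fₖ = F (s ℕ.* suc k)

  -- Both numerators are `falling (suc n) (suc k)`, with the first or the last factor split off.
  absorb′ : ∀ n k → embed (F (s ℕ.* suc n)) 𝔽.* fibopolynomial s n k
                  𝔽.≈ embed (F (s ℕ.* (suc n ∸ k))) 𝔽.* fibopolynomial s (suc n) k
  absorb′ n k = embed-*-fraction (*-congʳ {rising k}
    (trans (falling-snoc (suc n) k) (*-comm (falling (suc n) k) _)))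

  open Fibonomial.Expansion RationalFunctions.frac-ring (embed Defs.x) (embed Defs.y) s
    (embed ∘ F) 𝔽.refl 𝔽.refl F-rec cancel (fibopolynomial s) fibopolynomial[n,0]
    fibopolynomial≈0 absorb absorb′ public
    using (Recurrent; annihilated-product; signed-expansion)

-- Gibonacci sequences and the identity

open import Defs using (ℂ⟨x,y⟩; IsGibonacci; fibopolynomial; embed; y; _≈_; _*_; -_; 1#; _^_; product; sum≤; sumℕ)

private module ℂ⟨x,y⟩ = CommutativeRing RationalFunctions.frac-ring

module _ (s : ℕ) .{{_ : ℕ.NonZero s}} where
  open Fibopolynomial s using (Recurrent)

  -- Starting at the integer m gives a sequence indexed by naturals, as the expansion requires,
  -- whatever the sign of m.
  gibonacci-recurrent : ∀ {G} → IsGibonacci G → ∀ m → Recurrent (λ p → G (m ℤ.+ ℤ.+ p))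
  gibonacci-recurrent {G} G-rec m p = ≡.subst₂
    (λ a b → G (m ℤ.+ ℤ.+ suc (suc p)) ≈ embed Defs.x * G a Defs.+ embed y * G b)
    (shift₁ m (ℤ.+ p)) (shift₂ m (ℤ.+ p)) (G-rec (m ℤ.+ ℤ.+ suc (suc p)))
    where
    open ℤ-Solver.+-*-Solver using (solve; _:=_; _:+_; _:-_; con)
    shift₁ : ∀ m p → m ℤ.+ (ℤ.+ 2 ℤ.+ p) ℤ.- ℤ.+ 1 ≡ m ℤ.+ (ℤ.+ 1 ℤ.+ p)
    shift₁ = solve 2 (λ m p → m :+ (con (ℤ.+ 2) :+ p) :- con (ℤ.+ 1) := m :+ (con (ℤ.+ 1) :+ p)) ≡.refl
    shift₂ : ∀ m p → m ℤ.+ (ℤ.+ 2 ℤ.+ p) ℤ.- ℤ.+ 2 ≡ m ℤ.+ p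
    shift₂ = solve 2 (λ m p → m :+ (con (ℤ.+ 2) :+ p) :- con (ℤ.+ 2) := m :+ p) ≡.refl

corollary9 : (s l : ℕ) .{{_ : ℕ.NonZero s}} .{{_ : ℕ.NonZero l}}
    (k t : Vector ℕ l) (m : Vector ℤ l)
    (G : ℤ → ℂ⟨x,y⟩) → IsGibonacci G →
    let K = sumℕ (λ r → t r ℕ.* k r) in
    (n : ℕ) →
    product (λ r → G (ℤ.+ (s ℕ.* t r ℕ.* n) ℤ.+ m r) ^ k r)
    ≈
    (- 1#) ^ (s ℕ.+ 1) *
    sum≤ K (λ i → sum≤ i (λ j →
    (- 1#) ^ ((s ℕ.* j ℕ.+ 2 ℕ.* (s ℕ.+ 1)) ℕ.* (j ℕ.+ 1) / 2)
    * fibopolynomial s (K ℕ.+ 1) j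
    * product (λ r → G (m r ℤ.+ ℤ.+ (s ℕ.* t r ℕ.* (i ∸ j))) ^ k r)
    * embed y ^ (s ℕ.* j ℕ.* (j ∸ 1) / 2)
    * fibopolynomial s (n ℕ.+ K ∸ i) K))
corollary9 s l k t m G G-rec n = ℂ⟨x,y⟩.trans
  -- A sum in the multiplicative monoid is `product`. Only the order of the summands in the index of
  -- `G` changes.
  (Sum′.sum-cong-≋ {l} λ r → Exp.^-congˡ ℂ⟨x,y⟩.semiring (k r)
    (ℂ⟨x,y⟩.reflexive (≡.cong G (ℤₚ.+-comm (ℤ.+ (s ℕ.* t r ℕ.* n)) (m r)))))
  (signed-expansion _ _
    (annihilated-product l k t (λ r p → G (m r ℤ.+ ℤ.+ p))
      λ r → gibonacci-recurrent s {G} G-rec (m r)) n)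
  where
  open Fibopolynomial s
  module Sum′ = MonoidSum ℂ⟨x,y⟩.*-monoid
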